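{- Let $n,q\ge 1$ and let $f:\mathbb{R}^n\to\mathbb{R}^q$ be a partially defined function with domain $\mathrm{dom}(f)\subseteq\mathbb{R}^n$. Then $f$ is definable in $\mathrm{FO}(\mathbb{R},+,\leq)$ if and only if $f$ is $\mathrm{FO}(\mathbb{R},+,\leq)$-piecewise linear.
   Context: Functions are partial: $f:X\to Y$ is defined on a set $\mathrm{dom}(f)\subseteq X$, and its graph is $G_f=\{(x,y)\in X\times Y\mid x\in\mathrm{dom}(f),\ y=f(x)\}$. The restriction of $f$ to $D\subseteq\mathrm{dom}(f)$ is denoted $f|_D$. A polyhedral convex set of $\mathbb{R}^m$ is a set of the form $C=\{c\in\mathbb{R}^m\mid \forall j\in\{1,\dots,k\}\ \sum_{i=1}^m\alpha_j[i]\,c[i]\ \#_j\ \beta_j\}$ for some finite (possibly empty) sequence of tuples $(\alpha_j,\#_j,\beta_j)\in\mathbb{Q}^m\times\{<,\leq,=,\geq,>\}\times\mathbb{Q}$. $\mathrm{FO}(\mathbb{R},+,\leq)$ is the first-order logic of the real numbers with addition and order, where rational constants are allowed in formulas (equivalently, a constant symbol for $1$ is available). A set $S\subseteq\mathbb{R}^m$ is definable in $\mathrm{FO}(\mathbb{R},+,\leq)$ if it is the set of tuples satisfying some such formula; by Fourier--Motzkin quantifier elimination, this holds if and only if $S$ is a finite union of polyhedral convex sets. A partial function $f:\mathbb{R}^n\to\mathbb{R}^q$ is definable in $\mathrm{FO}(\mathbb{R},+,\leq)$ if its graph $G_f\subseteq\mathbb{R}^{n+q}$ is. A partial function $f:\mathbb{R}^n\to\mathbb{R}^q$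 is linear (short for $\mathbb{Q}$-linear; "affine" in other terminology) if there exist a matrix $M\in\mathbb{Q}^{q\times n}$ and a vector $v\in\mathbb{Q}^q$ such that $f(a)=Ma+v$ for all $a\in\mathrm{dom}(f)$. It is $\mathrm{FO}(\mathbb{R},+,\leq)$-piecewise linear if there is a finite partition $\Pi$ of $\mathrm{dom}(f)$ such that every $X\in\Pi$ is definable in $\mathrm{FO}(\mathbb{R},+,\leq)$ and $f|_X$ is linear for every $X\in\Pi$. -}

module Defs where

open import Data.Fin using (Fin)
open import Data.Nat as ℕ using (ℕ)
import Data.Nat.Properties as ℕ
open import Data.Product using (Σ; ∃; _×_; _,_; proj₁; proj₂)
open import Data.Rational as ℚ using (ℚ; 0ℚ; 1ℚ; ½)
import Data.Rational.Properties as ℚ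
open import Data.Rational.Solver using (module +-*-Solver)
open import Data.Sum using (_⊎_)
open import Data.Vec.Functional as Vec using (Vector)
open import Data.Vec.Functional.Relation.Binary.Pointwise using (Pointwise)
open import Function using (_⇔_)
open import Level using (Level; 0ℓ; suc)
open import Relation.Binary using (_Respects_)
open import Relation.Binary.PropositionalEquality
  using (_≡_; _≢_; refl; sym; cong; subst; module ≡-Reasoning)
open import Relation.Nullary using (¬_)
open import Relation.Unary using (Pred; _⊆_; _∩_; Satisfiable; Empty)

private
  variable
    ℓ : Level
    m n q : ℕ

------------------------------------------------------------------------
-- Real numbers: Cauchy sequences of rationals, with equality _≈_.
-- Only the structure used by FO(ℝ,+,≤) and by ℚ-linear maps is defined:
-- addition, order, rational constants and rational scalar multiples.

IsCauchy : (ℕ → ℚ) → Set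
IsCauchy s = ∀ ε → 0ℚ ℚ.< ε →
  ∃ λ N → ∀ i j → N ℕ.≤ i → N ℕ.≤ j → ℚ.∣ s i ℚ.- s j ∣ ℚ.< ε

record ℝ : Set where
  constructor mkℝ
  field
    seq    : ℕ → ℚ
    cauchy : IsCauchy seq

open ℝ public

infix  4 _≈_ _≤ᴿ_ _≋_
infixl 6 _+ᴿ_
infixl 7 _·_

_≈_ : ℝ → ℝ → Set
x ≈ y = ∀ ε → 0ℚ ℚ.< ε →
  ∃ λ N → ∀ i → N ℕ.≤ i → ℚ.∣ seq x i ℚ.- seq y i ∣ ℚ.< ε

_≤ᴿ_ : ℝ → ℝ → Set
x ≤ᴿ y = ∀ ε → 0ℚ ℚ.< ε →
  ∃ λ N → ∀ i → N ℕ.≤ i → seq x i ℚ.< seq y i ℚ.+ ε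

0<½* : ∀ {ε} → 0ℚ ℚ.< ε → 0ℚ ℚ.< ½ ℚ.* ε
0<½* {ε} 0<ε = subst (ℚ._< ½ ℚ.* ε) (ℚ.*-zeroʳ ½) (ℚ.*-monoʳ-<-pos ½ 0<ε)

½+½ : ∀ ε → ½ ℚ.* ε ℚ.+ ½ ℚ.* ε ≡ ε
½+½ = solve 1 (λ e → con ½ :* e :+ con ½ :* e := e) refl
  where open +-*-Solver

∣+∣<ε : ∀ {a b ε} → ℚ.∣ a ∣ ℚ.< ½ ℚ.* ε → ℚ.∣ b ∣ ℚ.< ½ ℚ.* ε →
        ℚ.∣ a ℚ.+ b ∣ ℚ.< ε
∣+∣<ε {a} {b} {ε} a< b< =
  subst (ℚ.∣ a ℚ.+ b ∣ ℚ.<_) (½+½ ε)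
    (ℚ.≤-<-trans (ℚ.∣p+q∣≤∣p∣+∣q∣ a b) (ℚ.+-mono-< a< b<))

interchange : ∀ a b c d →
  (a ℚ.- c) ℚ.+ (b ℚ.- d) ≡ (a ℚ.+ b) ℚ.- (c ℚ.+ d)
interchange = solve 4 (λ a b c d →
  (a :- c) :+ (b :- d) := (a :+ b) :- (c :+ d)) refl
  where open +-*-Solver

telescope : ∀ a b c → (a ℚ.- b) ℚ.+ (b ℚ.- c) ≡ a ℚ.- c
telescope = solve 3 (λ a b c → (a :- b) :+ (b :- c) := a :- c) refl
  where open +-*-Solver

∣-∣-comm : ∀ a b → ℚ.∣ a ℚ.- b ∣ ≡ ℚ.∣ b ℚ.- a ∣
∣-∣-comm a b = begin
  ℚ.∣ a ℚ.- b ∣         ≡⟨ cong ℚ.∣_∣ (neg a b) ⟩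
  ℚ.∣ ℚ.- (b ℚ.- a) ∣   ≡⟨ ℚ.∣-p∣≡∣p∣ (b ℚ.- a) ⟩
  ℚ.∣ b ℚ.- a ∣         ∎
  where
  open ≡-Reasoning
  open +-*-Solver
  neg : ∀ a b → a ℚ.- b ≡ ℚ.- (b ℚ.- a)
  neg = solve 2 (λ a b → a :- b := :- (b :- a)) refl

≈-sym : ∀ {x y} → x ≈ y → y ≈ x
≈-sym {x} {y} x≈y ε 0<ε = let N , p = x≈y ε 0<ε in
  N , λ i N≤i → subst (ℚ._< ε) (∣-∣-comm (seq x i) (seq y i)) (p i N≤i)

≈-trans : ∀ {x y z} → x ≈ y → y ≈ z → x ≈ z
≈-trans {x} {y} {z} x≈y y≈z ε 0<ε =
  let M , p = x≈y (½ ℚ.* ε) (0<½* 0<ε)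
      N , r = y≈z (½ ℚ.* ε) (0<½* 0<ε)
  in M ℕ.⊔ N , λ i MN≤i →
     subst (λ d → ℚ.∣ d ∣ ℚ.< ε) (telescope (seq x i) (seq y i) (seq z i))
       (∣+∣<ε (p i (ℕ.m⊔n≤o⇒m≤o M N MN≤i)) (r i (ℕ.m⊔n≤o⇒n≤o M N MN≤i)))

fromℚ : ℚ → ℝ
fromℚ c = mkℝ (λ _ → c) λ ε 0<ε →
  0 , λ _ _ _ _ → subst (λ d → ℚ.∣ d ∣ ℚ.< ε) (sym (ℚ.+-inverseʳ c)) 0<ε

_+ᴿ_ : ℝ → ℝ → ℝ
x +ᴿ y = mkℝ (λ i → seq x i ℚ.+ seq y i) λ ε 0<ε →
  let M , p = cauchy x (½ ℚ.* ε) (0<½* 0<ε)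
      N , r = cauchy y (½ ℚ.* ε) (0<½* 0<ε)
  in M ℕ.⊔ N , λ i j MN≤i MN≤j →
     subst (λ d → ℚ.∣ d ∣ ℚ.< ε)
       (interchange (seq x i) (seq y i) (seq x j) (seq y j))
       (∣+∣<ε (p i j (ℕ.m⊔n≤o⇒m≤o M N MN≤i) (ℕ.m⊔n≤o⇒m≤o M N MN≤j))
              (r i j (ℕ.m⊔n≤o⇒n≤o M N MN≤i) (ℕ.m⊔n≤o⇒n≤o M N MN≤j)))

_·_ : ℚ → ℝ → ℝ
c · x = mkℝ (λ i → c ℚ.* seq x i) isCauchy
  where
  b : ℚ
  b = 1ℚ ℚ.+ ℚ.∣ c ∣

  instance
    b-pos : ℚ.Positive b
    b-pos = ℚ.pos+nonNeg⇒pos 1ℚ ℚ.∣ c ∣ {{ℚ.∣-∣-nonNeg c}}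

    b≢0 : ℚ.NonZero b
    b≢0 = ℚ.pos⇒nonZero b

    1/b-pos : ℚ.Positive (ℚ.1/ b)
    1/b-pos = ℚ.1/pos⇒pos b

  isCauchy : IsCauchy (λ i → c ℚ.* seq x i)
  isCauchy ε 0<ε =
    let N , p = cauchy x (ℚ.1/ b ℚ.* ε) 0<δ
    in N , λ i j N≤i N≤j → bound (seq x i) (seq x j) (p i j N≤i N≤j)
    where
    0<δ : 0ℚ ℚ.< ℚ.1/ b ℚ.* ε
    0<δ = subst (ℚ._< ℚ.1/ b ℚ.* ε) (ℚ.*-zeroʳ (ℚ.1/ b))
            (ℚ.*-monoʳ-<-pos (ℚ.1/ b) 0<ε)

    ∣c∣≤b : ℚ.∣ c ∣ ℚ.≤ b
    ∣c∣≤b = subst (ℚ._≤ b) (ℚ.+-identityˡ ℚ.∣ c ∣)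
              (ℚ.+-monoˡ-≤ ℚ.∣ c ∣ (ℚ.nonNegative⁻¹ 1ℚ))

    bound : ∀ s t → ℚ.∣ s ℚ.- t ∣ ℚ.< ℚ.1/ b ℚ.* ε →
            ℚ.∣ c ℚ.* s ℚ.- c ℚ.* t ∣ ℚ.< ε
    bound s t s-t< = begin-strict
      ℚ.∣ c ℚ.* s ℚ.- c ℚ.* t ∣    ≡⟨ cong ℚ.∣_∣ (factor c s t) ⟩
      ℚ.∣ c ℚ.* (s ℚ.- t) ∣        ≡⟨ ℚ.∣p*q∣≡∣p∣*∣q∣ c (s ℚ.- t) ⟩
      ℚ.∣ c ∣ ℚ.* ℚ.∣ s ℚ.- t ∣    ≤⟨ ℚ.*-monoʳ-≤-nonNeg ℚ.∣ s ℚ.- t ∣ {{ℚ.∣-∣-nonNeg (s ℚ.- t)}} ∣c∣≤b ⟩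
      b ℚ.* ℚ.∣ s ℚ.- t ∣          <⟨ ℚ.*-monoʳ-<-pos b s-t< ⟩
      b ℚ.* (ℚ.1/ b ℚ.* ε)         ≡⟨ ℚ.*-assoc b (ℚ.1/ b) ε ⟨
      b ℚ.* ℚ.1/ b ℚ.* ε           ≡⟨ cong (ℚ._* ε) (ℚ.*-inverseʳ b) ⟩
      1ℚ ℚ.* ε                     ≡⟨ ℚ.*-identityˡ ε ⟩
      ε                            ∎
      where
      open ℚ.≤-Reasoning
      open +-*-Solver
      factor : ∀ c s t → c ℚ.* s ℚ.- c ℚ.* t ≡ c ℚ.* (s ℚ.- t)
      factor = solve 3 (λ c s t → c :* s :- c :* t := c :* (s :- t)) refl

------------------------------------------------------------------------
-- ℝᵐ, its subsets, and partial functions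

ℝ^_ : ℕ → Set
ℝ^ m = Vector ℝ m

_≋_ : ℝ^ m → ℝ^ m → Set
_≋_ = Pointwise _≈_

record Subset (m : ℕ) (ℓ : Level) : Set (suc ℓ) where
  field
    pred : Pred (ℝ^ m) ℓ
    resp : pred Respects _≋_

open Subset public

infix 4 _∈_

_∈_ : ℝ^ m → Subset m ℓ → Set ℓ
x ∈ S = pred S x

-- `cong-apply` also makes the value independent of the membership proof.
record PartialFunction (n q : ℕ) (ℓ : Level) : Set (suc ℓ) where
  field
    dom        : Subset n ℓ
    apply      : ∀ x → x ∈ dom → ℝ^ q
    cong-apply : ∀ {x y} (x∈ : x ∈ dom) (y∈ : y ∈ dom) →
                 x ≋ y → apply x x∈ ≋ apply y y∈

open PartialFunction public

Graph : PartialFunction n q ℓ → Subset (n ℕ.+ q) ℓ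
Graph {n} f = record
  { pred = λ z → Σ (Vec.take n z ∈ dom f) λ x∈ →
                   Vec.drop n z ≋ apply f (Vec.take n z) x∈
  ; resp = λ {z} {w} z≋w (x∈ , y≋fx) →
      let x≋x′ = λ i → z≋w _
          x′∈  = resp (dom f) x≋x′ x∈
      in x′∈ , λ i →
         ≈-trans {Vec.drop n w i} {Vec.drop n z i} {apply f (Vec.take n w) x′∈ i}
           (≈-sym {Vec.drop n z i} {Vec.drop n w i} (z≋w _))
           (≈-trans {Vec.drop n z i} {apply f (Vec.take n z) x∈ i} {apply f (Vec.take n w) x′∈ i}
             (y≋fx i) (cong-apply f x∈ x′∈ x≋x′ i))
  }

restrict : (f : PartialFunction n q ℓ) (D : Subset n ℓ) →
           pred D ⊆ pred (dom f) → PartialFunction n q ℓ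
restrict f D D⊆dom = record
  { dom        = D
  ; apply      = λ x x∈D → apply f x (D⊆dom x∈D)
  ; cong-apply = λ x∈D y∈D → cong-apply f (D⊆dom x∈D) (D⊆dom y∈D)
  }

------------------------------------------------------------------------
-- First-order logic FO(ℝ,+,≤) with rational constants.
-- The index is the number of free variables; variables are de Bruijn
-- indices, and a quantifier binds index 0.

data Term (m : ℕ) : Set where
  var   : Fin m → Term m
  const : ℚ → Term m
  _⊕_   : Term m → Term m → Term m

data Formula (m : ℕ) : Set where
  _≐_ _≼_         : Term m → Term m → Formula m
  not_            : Formula m → Formula m
  _and_ _or_ _⇒_  : Formula m → Formula m → Formula m
  all_ ex_        : Formula (ℕ.suc m) → Formula m

eval : Term m → ℝ^ m → ℝ
eval (var i)   ρ = ρ i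
eval (const c) ρ = fromℚ c
eval (s ⊕ t)   ρ = eval s ρ +ᴿ eval t ρ

infix 4 _⊨_

_⊨_ : ℝ^ m → Formula m → Set
ρ ⊨ (s ≐ t)   = eval s ρ ≈ eval t ρ
ρ ⊨ (s ≼ t)   = eval s ρ ≤ᴿ eval t ρ
ρ ⊨ (not φ)   = ¬ (ρ ⊨ φ)
ρ ⊨ (φ and ψ) = (ρ ⊨ φ) × (ρ ⊨ ψ)
ρ ⊨ (φ or ψ)  = (ρ ⊨ φ) ⊎ (ρ ⊨ ψ)
ρ ⊨ (φ ⇒ ψ)   = ρ ⊨ φ → ρ ⊨ ψ
ρ ⊨ (all φ)   = ∀ a → (a Vec.∷ ρ) ⊨ φ
ρ ⊨ (ex φ)    = ∃ λ a → (a Vec.∷ ρ) ⊨ φ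

Definable : Subset m ℓ → Set ℓ
Definable {m} S = ∃ λ (φ : Formula m) → ∀ x → x ∈ S ⇔ x ⊨ φ

DefinableFunction : PartialFunction n q ℓ → Set ℓ
DefinableFunction f = Definable (Graph f)

------------------------------------------------------------------------
-- Piecewise linear functions

Matrix : ℕ → ℕ → Set
Matrix q n = Vector (Vector ℚ n) q

∑ : Vector ℝ n → ℝ
∑ = Vec.foldr _+ᴿ_ (fromℚ 0ℚ)

affine : Matrix q n → Vector ℚ q → ℝ^ n → ℝ^ q
affine M v a i = ∑ (λ j → M i j · a j) +ᴿ fromℚ (v i)

Linear : PartialFunction n q ℓ → Set ℓ
Linear {n} {q} f = ∃ λ (M : Matrix q n) → ∃ λ (v : Vector ℚ q) →
  ∀ a (a∈ : a ∈ dom f) → apply f a a∈ ≋ affine M v a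

record FinitePartition (D : Subset n ℓ) : Set (suc ℓ) where
  field
    size      : ℕ
    block     : Fin size → Subset n ℓ
    included  : ∀ i → pred (block i) ⊆ pred D
    covering  : ∀ {x} → x ∈ D → ∃ λ i → x ∈ block i
    disjoint  : ∀ {i j} → i ≢ j → Empty (pred (block i) ∩ pred (block j))
    inhabited : ∀ i → Satisfiable (pred (block i))

PiecewiseLinear : PartialFunction n q ℓ → Set (suc ℓ)
PiecewiseLinear f = Σ (FinitePartition (dom f)) λ Π →
  let open FinitePartition Π in
  ∀ i → Definable (block i) × Linear (restrict f (block i) (included i))

{-# OPTIONS --safe #-}
module Submission where

-- Instead of eliminating quantifiers, we attach to every formula φ a finite
-- list of affine forms whose signs at a point decide whether φ holds there.
-- For a quantifier over x₀, write the forms involving x₀ as multiples of x₀ - t: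
-- if two points order the thresholds t in the same way, then every value of x₀
-- over the first has a counterpart over the second in the same position, because
-- ℝ is a dense order without endpoints. So it suffices to record the forms
-- without x₀ and the differences of thresholds.
--
-- If φ(y , x) has exactly one solution y over x, then y is one of the finitely
-- many thresholds, since otherwise y could be moved without changing any sign.
-- Applied to the coordinate functions of f, this covers dom f by the finitely
-- many definable sets on which each coordinate agrees with a chosen threshold.
-- Conversely, the graph of a rational affine map is defined by clearing
-- denominators.

open import Defs
open import Axiom.ExcludedMiddle using (ExcludedMiddle)
open import Data.Nat using (ℕ; _≤_)
open import Function using (_⇔_)

open import Data.Empty using (⊥-elim)
open import Data.Fin using (Fin; zero; suc; _↑ˡ_; _↑ʳ_; splitAt)
open import Data.Integer as ℤ using (+_; -[1+_])
import Data.Integer.Properties as ℤ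
open import Data.List using (List; []; _∷_; _++_; map; filter; cartesianProductWith)
open import Data.List.Membership.Propositional using () renaming (_∈_ to _∈ₗ_)
open import Data.List.Membership.Propositional.Properties
  using (∈-map⁺; ∈-map⁻; ∈-++⁺ˡ; ∈-++⁺ʳ; ∈-++⁻; ∈-cartesianProductWith⁺; ∈-filter⁺; ∈-filter⁻)
open import Data.List.Relation.Unary.Any using (here; there)
open import Data.Nat as ℕ using ()
open import Data.Nat.Coprimality as Coprimality using (1-coprimeTo)
import Data.Nat.Properties as ℕ
open import Data.Product using (Σ; ∃; _×_; _,_; proj₁; proj₂)
open import Data.Rational as ℚ using (ℚ; 0ℚ; 1ℚ; ½; mkℚ)
import Data.Rational.Properties as ℚ
import Data.Rational.Unnormalised as ℚᵘ
import Data.Rational.Unnormalised.Properties as ℚᵘ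
open import Data.Rational.Solver using (module +-*-Solver)
open import Data.Sum as Sum using (_⊎_; inj₁; inj₂; [_,_]′)
open import Data.Vec.Functional as Vec using (Vector)
open import Data.Vec.Functional.Properties using (lookup-++ˡ; lookup-++ʳ)
open import Function using (mk⇔; Equivalence; _∘_; id)
open import Function.Properties.Equivalence using (⇔-isEquivalence)
open import Level using (0ℓ; Lift; lift; lower)
open import Relation.Binary using (IsEquivalence; Tri; tri<; tri≈; tri>)
open import Relation.Binary.PropositionalEquality
  using (_≡_; _≢_; refl; sym; trans; cong; cong₂; subst; subst₂; module ≡-Reasoning)
open import Relation.Nullary using (¬_; Dec; yes; no; contradiction)
open import Relation.Nullary.Decidable using (map′)

open Equivalence using (to; from)
open +-*-Solver using (solve; _:=_; _:+_; _:*_; _:-_; :-_; con)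

private
  variable
    k m n q : ℕ

-- Order on ℝ

infix 4 _⊑_ _⊏_

-- _≤ᴿ_ unfolds to a statement about sequences, from which Agda cannot
-- recover the two reals; the record makes them inferable.
record _⊑_ (x y : ℝ) : Set where
  constructor mk⊑
  field
    un⊑ : x ≤ᴿ y

open _⊑_

_⊏_ : ℝ → ℝ → Set
x ⊏ y = ¬ (y ⊑ x)

-- A tolerance `ε` for the new pair is met by using `ε / c` for the old one. Only differences of
-- entries enter, so translations and, after exchanging the reals, negative multiples are covered
-- too.
scale-⊑ : ∀ {x y x′ y′} c .{{_ : ℚ.Positive c}} →
  (∀ i → seq y′ i ℚ.- seq x′ i ≡ c ℚ.* (seq y i ℚ.- seq x i)) →
  x ⊑ y → x′ ⊑ y′
scale-⊑ {x} {y} {x′} {y′} c eq (mk⊑ x≤y) = mk⊑ λ ε 0<ε →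
  let N , p = x≤y (ℚ.1/ c ℚ.* ε) (0<δ 0<ε)
  in N , λ i N≤i → bound (seq x i) (seq y i) (seq x′ i) (seq y′ i) (eq i) (p i N≤i)
  where
  instance
    c≢0 : ℚ.NonZero c
    c≢0 = ℚ.pos⇒nonZero c

    1/c-pos : ℚ.Positive (ℚ.1/ c)
    1/c-pos = ℚ.1/pos⇒pos c

  0<δ : ∀ {ε} → 0ℚ ℚ.< ε → 0ℚ ℚ.< ℚ.1/ c ℚ.* ε
  0<δ {ε} 0<ε = subst (ℚ._< ℚ.1/ c ℚ.* ε) (ℚ.*-zeroʳ (ℚ.1/ c)) (ℚ.*-monoʳ-<-pos (ℚ.1/ c) 0<ε)

  bound : ∀ {ε} a b a′ b′ → b′ ℚ.- a′ ≡ c ℚ.* (b ℚ.- a) →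
          a ℚ.< b ℚ.+ ℚ.1/ c ℚ.* ε → a′ ℚ.< b′ ℚ.+ ε
  bound {ε} a b a′ b′ eq a<b = begin-strict
    a′                                                  ≡⟨ solve 2 (λ a′ b′ → a′ := b′ :- (b′ :- a′)) refl a′ b′ ⟩
    b′ ℚ.- (b′ ℚ.- a′)                                  ≡⟨ cong (λ d → b′ ℚ.- d) eq ⟩
    b′ ℚ.- c ℚ.* (b ℚ.- a)                              ≡⟨ solve 4 (λ a b b′ c → b′ :- c :* (b :- a) := (b′ :- c :* b) :+ c :* a) refl a b b′ c ⟩
    (b′ ℚ.- c ℚ.* b) ℚ.+ c ℚ.* a                        <⟨ ℚ.+-monoʳ-< (b′ ℚ.- c ℚ.* b) (ℚ.*-monoʳ-<-pos c a<b) ⟩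
    (b′ ℚ.- c ℚ.* b) ℚ.+ c ℚ.* (b ℚ.+ ℚ.1/ c ℚ.* ε)     ≡⟨ solve 5 (λ b b′ c d e → (b′ :- c :* b) :+ c :* (b :+ d :* e) := b′ :+ (c :* d) :* e) refl b b′ c (ℚ.1/ c) ε ⟩
    b′ ℚ.+ (c ℚ.* ℚ.1/ c) ℚ.* ε                         ≡⟨ cong (λ d → b′ ℚ.+ d ℚ.* ε) (ℚ.*-inverseʳ c) ⟩
    b′ ℚ.+ 1ℚ ℚ.* ε                                     ≡⟨ cong (b′ ℚ.+_) (ℚ.*-identityˡ ε) ⟩
    b′ ℚ.+ ε                                            ∎
    where open ℚ.≤-Reasoning

a-b<c⇒a<b+c : ∀ {a b c} → ℚ.∣ a ℚ.- b ∣ ℚ.< c → a ℚ.< b ℚ.+ c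
a-b<c⇒a<b+c {a} {b} {c} p = begin-strict
  a                        ≡⟨ solve 2 (λ a b → a := b :+ (a :- b)) refl a b ⟩
  b ℚ.+ (a ℚ.- b)          ≤⟨ ℚ.+-monoʳ-≤ b (p≤∣p∣ (a ℚ.- b)) ⟩
  b ℚ.+ ℚ.∣ a ℚ.- b ∣      <⟨ ℚ.+-monoʳ-< b p ⟩
  b ℚ.+ c                  ∎
  where
  open ℚ.≤-Reasoning
  p≤∣p∣ : ∀ p → p ℚ.≤ ℚ.∣ p ∣
  p≤∣p∣ p with ℚ.≤-total 0ℚ p
  ... | inj₁ 0≤p = ℚ.≤-reflexive (sym (ℚ.0≤p⇒∣p∣≡p 0≤p))
  ... | inj₂ p≤0 = ℚ.≤-trans p≤0 (ℚ.0≤∣p∣ p)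

≈⇒⊑ : ∀ {x y} → x ≈ y → x ⊑ y
≈⇒⊑ x≈y = mk⊑ λ ε 0<ε → let N , p = x≈y ε 0<ε in
  N , λ i N≤i → a-b<c⇒a<b+c (p i N≤i)

⊑-antisym : ∀ {x y} → x ⊑ y → y ⊑ x → x ≈ y
⊑-antisym {x} {y} (mk⊑ x≤y) (mk⊑ y≤x) ε 0<ε =
  let M , p = x≤y ε 0<ε
      N , r = y≤x ε 0<ε
  in M ℕ.⊔ N , λ i MN≤i →
     bound (seq x i) (seq y i) (p i (ℕ.m⊔n≤o⇒m≤o M N MN≤i)) (r i (ℕ.m⊔n≤o⇒n≤o M N MN≤i))
  where
  drop-+ : ∀ a b → a ℚ.< b ℚ.+ ε → a ℚ.- b ℚ.< ε
  drop-+ a b a<b+ε = subst (a ℚ.- b ℚ.<_) (solve 2 (λ b e → b :+ e :- b := e) refl b ε)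
    (ℚ.+-monoˡ-< (ℚ.- b) a<b+ε)

  bound : ∀ a b → a ℚ.< b ℚ.+ ε → b ℚ.< a ℚ.+ ε → ℚ.∣ a ℚ.- b ∣ ℚ.< ε
  bound a b a<b+ε b<a+ε with ℚ.≤-total 0ℚ (a ℚ.- b)
  ... | inj₁ 0≤a-b = subst (ℚ._< ε) (sym (ℚ.0≤p⇒∣p∣≡p 0≤a-b)) (drop-+ a b a<b+ε)
  ... | inj₂ a-b≤0 = subst (ℚ._< ε) (trans (sym (ℚ.0≤p⇒∣p∣≡p 0≤b-a)) (∣-∣-comm b a)) (drop-+ b a b<a+ε)
    where
    0≤b-a : 0ℚ ℚ.≤ b ℚ.- a
    0≤b-a = subst (0ℚ ℚ.≤_) (solve 2 (λ a b → :- (a :- b) := b :- a) refl a b) (ℚ.neg-antimono-≤ a-b≤0)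

⊑-trans : ∀ {x y z} → x ⊑ y → y ⊑ z → x ⊑ z
⊑-trans {x} {y} {z} (mk⊑ x≤y) (mk⊑ y≤z) = mk⊑ λ ε 0<ε →
  let M , p = x≤y (½ ℚ.* ε) (0<½* 0<ε)
      N , r = y≤z (½ ℚ.* ε) (0<½* 0<ε)
  in M ℕ.⊔ N , λ i MN≤i →
     subst (seq x i ℚ.<_)
       (trans (ℚ.+-assoc (seq z i) _ _) (cong (seq z i ℚ.+_) (½+½ ε)))
       (ℚ.<-trans (p i (ℕ.m⊔n≤o⇒m≤o M N MN≤i))
                  (ℚ.+-monoˡ-< (½ ℚ.* ε) (r i (ℕ.m⊔n≤o⇒n≤o M N MN≤i))))

≗⇒≈ : ∀ {x y} → (∀ i → seq x i ≡ seq y i) → x ≈ y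
≗⇒≈ {x} {y} eq ε 0<ε = 0 , λ i _ →
  subst (λ d → ℚ.∣ d ∣ ℚ.< ε)
    (sym (trans (cong (ℚ._- seq y i) (eq i)) (ℚ.+-inverseʳ (seq y i)))) 0<ε

≈-refl : ∀ {x} → x ≈ x
≈-refl {x} = ≗⇒≈ {x} {x} λ _ → refl

≡⇒≈ : ∀ {x y} → x ≡ y → x ≈ y
≡⇒≈ {x} refl = ≈-refl {x}

⊑-refl : ∀ {x} → x ⊑ x
⊑-refl {x} = ≈⇒⊑ (≈-refl {x})

⊏-⊑-trans : ∀ {x y z} → x ⊏ y → y ⊑ z → x ⊏ z
⊏-⊑-trans x<y y≤z z≤x = x<y (⊑-trans y≤z z≤x)

+-cong : ∀ {x x′ y y′} → x ≈ x′ → y ≈ y′ → x +ᴿ y ≈ x′ +ᴿ y′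
+-cong {x} {x′} {y} {y′} x≈x′ y≈y′ ε 0<ε =
  let M , p = x≈x′ (½ ℚ.* ε) (0<½* 0<ε)
      N , r = y≈y′ (½ ℚ.* ε) (0<½* 0<ε)
  in M ℕ.⊔ N , λ i MN≤i →
     subst (λ d → ℚ.∣ d ∣ ℚ.< ε) (interchange (seq x i) (seq y i) (seq x′ i) (seq y′ i))
       (∣+∣<ε (p i (ℕ.m⊔n≤o⇒m≤o M N MN≤i)) (r i (ℕ.m⊔n≤o⇒n≤o M N MN≤i)))

-- Equality is split into two inequalities, to which `scale-⊑` applies; a negative `c` exchanges
-- them.
·-cong : ∀ {x y} c → x ≈ y → c · x ≈ c · y
·-cong {x} {y} c x≈y with ℚ.<-cmp 0ℚ c
... | tri< 0<c _ _ = ⊑-antisym {c · x} {c · y}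
  (scale-⊑ {x} {y} c (λ i → distrib c (seq x i) (seq y i)) (≈⇒⊑ x≈y))
  (scale-⊑ {y} {x} c (λ i → distrib c (seq y i) (seq x i)) (≈⇒⊑ (≈-sym {x} {y} x≈y)))
  where
  instance
    c-pos : ℚ.Positive c
    c-pos = ℚ.positive 0<c
  distrib : ∀ c a b → c ℚ.* b ℚ.- c ℚ.* a ≡ c ℚ.* (b ℚ.- a)
  distrib = solve 3 (λ c a b → c :* b :- c :* a := c :* (b :- a)) refl
... | tri≈ _ refl _ = ≗⇒≈ {0ℚ · x} {0ℚ · y} λ i →
  trans (ℚ.*-zeroˡ (seq x i)) (sym (ℚ.*-zeroˡ (seq y i)))
... | tri> _ _ c<0 = ⊑-antisym {c · x} {c · y}
  (scale-⊑ {y} {x} (ℚ.- c) (λ i → distrib c (seq y i) (seq x i)) (≈⇒⊑ (≈-sym {x} {y} x≈y)))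
  (scale-⊑ {x} {y} (ℚ.- c) (λ i → distrib c (seq x i) (seq y i)) (≈⇒⊑ x≈y))
  where
  instance
    -c-pos : ℚ.Positive (ℚ.- c)
    -c-pos = ℚ.positive (ℚ.neg-antimono-< c<0)
  distrib : ∀ c a b → c ℚ.* a ℚ.- c ℚ.* b ≡ ℚ.- c ℚ.* (b ℚ.- a)
  distrib = solve 3 (λ c a b → c :* a :- c :* b := :- c :* (b :- a)) refl

-- Pairs of reals in the same order

-- Two equivalences are recorded instead of a case among less, equal and greater, so that agreement
-- can be proved without deciding which case holds.
record SameOrder (x y x′ y′ : ℝ) : Set where
  constructor mkSame
  field
    same-≤ : x ⊑ y ⇔ x′ ⊑ y′
    same-≥ : y ⊑ x ⇔ y′ ⊑ x′

open SameOrder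

private
  module ⇔ {ℓ} = IsEquivalence (⇔-isEquivalence {ℓ})

same-sym : ∀ {x y x′ y′} → SameOrder x y x′ y′ → SameOrder x′ y′ x y
same-sym (mkSame p r) = mkSame (⇔.sym p) (⇔.sym r)

same-trans : ∀ {x y x′ y′ x″ y″} →
  SameOrder x y x′ y′ → SameOrder x′ y′ x″ y″ → SameOrder x y x″ y″
same-trans (mkSame p r) (mkSame p′ r′) = mkSame (⇔.trans p p′) (⇔.trans r r′)

same-swap : ∀ {x y x′ y′} → SameOrder x y x′ y′ → SameOrder y x y′ x′
same-swap (mkSame p r) = mkSame r p

same-cong : ∀ {x y x′ y′} → x ≈ x′ → y ≈ y′ → SameOrder x y x′ y′
same-cong {x} {y} {x′} {y′} x≈x′ y≈y′ = mkSame
  (mk⇔ (λ p → ⊑-trans x′≤x (⊑-trans p y≤y′)) (λ p → ⊑-trans x≤x′ (⊑-trans p y′≤y)))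
  (mk⇔ (λ p → ⊑-trans y′≤y (⊑-trans p x≤x′)) (λ p → ⊑-trans y≤y′ (⊑-trans p x′≤x)))
  where
  x≤x′ = ≈⇒⊑ x≈x′
  x′≤x = ≈⇒⊑ (≈-sym {x} {x′} x≈x′)
  y≤y′ = ≈⇒⊑ y≈y′
  y′≤y = ≈⇒⊑ (≈-sym {y} {y′} y≈y′)

same-≈ : ∀ {x y x′ y′} → SameOrder x y x′ y′ → x ≈ y → x′ ≈ y′
same-≈ {x} {y} (mkSame p r) x≈y = ⊑-antisym (to p (≈⇒⊑ x≈y)) (to r (≈⇒⊑ (≈-sym {x} {y} x≈y)))

same-scale : ∀ {x y x′ y′} c .{{_ : ℚ.Positive c}} →
  (∀ i → seq y′ i ℚ.- seq x′ i ≡ c ℚ.* (seq y i ℚ.- seq x i)) →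
  SameOrder x y x′ y′
same-scale {x} {y} {x′} {y′} c eq = mkSame
  (mk⇔ (scale-⊑ c eq) (scale-⊑ (ℚ.1/ c) (unscale eq)))
  (mk⇔ (scale-⊑ c eq′) (scale-⊑ (ℚ.1/ c) (unscale eq′)))
  where
  instance
    c≢0 : ℚ.NonZero c
    c≢0 = ℚ.pos⇒nonZero c

    1/c-pos : ℚ.Positive (ℚ.1/ c)
    1/c-pos = ℚ.1/pos⇒pos c

  eq′ : ∀ i → seq x′ i ℚ.- seq y′ i ≡ c ℚ.* (seq x i ℚ.- seq y i)
  eq′ i = trans (neg (seq x′ i) (seq y′ i)) (trans (cong ℚ.-_ (eq i))
    (solve 3 (λ c a b → :- (c :* (b :- a)) := c :* (a :- b)) refl c (seq x i) (seq y i)))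
    where
    neg : ∀ a b → a ℚ.- b ≡ ℚ.- (b ℚ.- a)
    neg = solve 2 (λ a b → a :- b := :- (b :- a)) refl

  unscale : ∀ {a b : ℕ → ℚ} → (∀ i → b i ≡ c ℚ.* a i) → ∀ i → a i ≡ ℚ.1/ c ℚ.* b i
  unscale {a} {b} e i = sym (begin
    ℚ.1/ c ℚ.* b i              ≡⟨ cong (ℚ.1/ c ℚ.*_) (e i) ⟩
    ℚ.1/ c ℚ.* (c ℚ.* a i)      ≡⟨ ℚ.*-assoc (ℚ.1/ c) c (a i) ⟨
    ℚ.1/ c ℚ.* c ℚ.* a i        ≡⟨ cong (ℚ._* a i) (ℚ.*-inverseˡ c) ⟩
    1ℚ ℚ.* a i                  ≡⟨ ℚ.*-identityˡ (a i) ⟩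
    a i                         ∎)
    where open ≡-Reasoning

same-shift : ∀ {x y x′ y′} → (∀ i → seq y′ i ℚ.- seq x′ i ≡ seq y i ℚ.- seq x i) →
  SameOrder x y x′ y′
same-shift {x} {y} eq = same-scale 1ℚ λ i →
  trans (eq i) (sym (ℚ.*-identityˡ (seq y i ℚ.- seq x i)))

-- Density and absence of endpoints

midpoint : ℝ → ℝ → ℝ
midpoint x y = ½ · (x +ᴿ y)

-- The difference of `x` and the midpoint is half that of `x` and `y`, so both pairs are ordered
-- alike.
⊏-midpoint : ∀ {x y} → x ⊏ y → x ⊏ midpoint x y
⊏-midpoint {x} {y} x<y m≤x = x<y (from (same-≤ (same-scale ½ λ i →
  solve 2 (λ a b → a :- con ½ :* (a :+ b) := con ½ :* (a :- b)) refl (seq x i) (seq y i))) m≤x)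

midpoint-⊏ : ∀ {x y} → x ⊏ y → midpoint x y ⊏ y
midpoint-⊏ {x} {y} x<y y≤m = x<y (from (same-≤ (same-scale ½ λ i →
  solve 2 (λ a b → con ½ :* (a :+ b) :- b := con ½ :* (a :- b)) refl (seq x i) (seq y i))) y≤m)

0⊏1 : fromℚ 0ℚ ⊏ fromℚ 1ℚ
0⊏1 (mk⊑ 1≤0) = let N , p = 1≤0 1ℚ (ℚ.positive⁻¹ 1ℚ) in
  ℚ.<-irrefl (sym (ℚ.+-identityˡ 1ℚ)) (p N ℕ.≤-refl)

⊏+1 : ∀ x → x ⊏ x +ᴿ fromℚ 1ℚ
⊏+1 x = 0⊏1 ∘ to (same-≤ (same-shift λ i →
  solve 1 (λ a → con 0ℚ :- con 1ℚ := a :- (a :+ con 1ℚ)) refl (seq x i)))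

-1⊏ : ∀ x → x +ᴿ fromℚ (ℚ.- 1ℚ) ⊏ x
-1⊏ x = 0⊏1 ∘ to (same-≤ (same-shift λ i →
  solve 1 (λ a → con 0ℚ :- con 1ℚ := (a :+ con (ℚ.- 1ℚ)) :- a) refl (seq x i)))

-- Affine forms

infixr 5 _◂_

-- a₀ ◂ a₁ ◂ … ◂ cst b stands for a₀ x₀ + a₁ x₁ + … + b.
data Aff : ℕ → Set where
  cst : ℚ → Aff 0
  _◂_ : ℚ → Aff m → Aff (ℕ.suc m)

⟦_⟧ : Aff m → ℝ^ m → ℝ
⟦ cst c ⟧ ρ = fromℚ c
⟦ c ◂ l ⟧ ρ = c · ρ zero +ᴿ ⟦ l ⟧ (Vec.tail ρ)

⟦⟧-cong : (l : Aff m) {ρ ρ′ : ℝ^ m} → ρ ≋ ρ′ → ⟦ l ⟧ ρ ≈ ⟦ l ⟧ ρ′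
⟦⟧-cong (cst c) _ = ≈-refl {fromℚ c}
⟦⟧-cong (c ◂ l) {ρ} {ρ′} ρ≋ρ′ =
  +-cong {c · ρ zero} {c · ρ′ zero} {⟦ l ⟧ (Vec.tail ρ)} {⟦ l ⟧ (Vec.tail ρ′)}
    (·-cong {ρ zero} {ρ′ zero} c (ρ≋ρ′ zero)) (⟦⟧-cong l (ρ≋ρ′ ∘ suc))

combine : ℚ → Aff m → ℚ → Aff m → Aff m
combine a (cst c) b (cst c′) = cst (a ℚ.* c ℚ.+ b ℚ.* c′)
combine a (c ◂ l) b (c′ ◂ l′) = (a ℚ.* c ℚ.+ b ℚ.* c′) ◂ combine a l b l′

seq-combine : ∀ a (l : Aff m) b l′ ρ i →
  seq (⟦ combine a l b l′ ⟧ ρ) i ≡ a ℚ.* seq (⟦ l ⟧ ρ) i ℚ.+ b ℚ.* seq (⟦ l′ ⟧ ρ) i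
seq-combine a (cst c) b (cst c′) ρ i = refl
seq-combine a (c ◂ l) b (c′ ◂ l′) ρ i =
  trans (cong ((a ℚ.* c ℚ.+ b ℚ.* c′) ℚ.* seq (ρ zero) i ℚ.+_) (seq-combine a l b l′ (Vec.tail ρ) i))
    (solve 7 (λ a c b c′ x y z →
        (a :* c :+ b :* c′) :* x :+ (a :* y :+ b :* z) := a :* (c :* x :+ y) :+ b :* (c′ :* x :+ z))
      refl a c b c′ (seq (ρ zero) i) (seq (⟦ l ⟧ (Vec.tail ρ)) i) (seq (⟦ l′ ⟧ (Vec.tail ρ)) i))

row : Vector ℚ m → ℚ → Aff m
row {ℕ.zero}  w b = cst b
row {ℕ.suc m} w b = w zero ◂ row (Vec.tail w) b

coefficients : Aff m → Vector ℚ m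
coefficients (c ◂ l) zero    = c
coefficients (c ◂ l) (suc i) = coefficients l i

constant : Aff m → ℚ
constant (cst b) = b
constant (c ◂ l) = constant l

-- The constant is added after the sum on the left but sits innermost in the form on the right, so
-- each coordinate costs one reassociation.
seq-row : ∀ (u : Vector ℝ m) (w : Vector ℚ m) b (x : ℝ^ m) i →
  (∀ j → seq (u j) i ≡ w j ℚ.* seq (x j) i) →
  seq (∑ u) i ℚ.+ b ≡ seq (⟦ row w b ⟧ x) i
seq-row {ℕ.zero}  u w b x i eq = ℚ.+-identityˡ b
seq-row {ℕ.suc m} u w b x i eq = trans
  (ℚ.+-assoc (seq (u zero) i) (seq (∑ (Vec.tail u)) i) b)
  (cong₂ ℚ._+_ (eq zero) (seq-row (Vec.tail u) (Vec.tail w) b (Vec.tail x) i (λ j → eq (suc j))))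

row-coefficients : (l : Aff m) → row (coefficients l) (constant l) ≡ l
row-coefficients (cst b) = refl
row-coefficients (c ◂ l) = cong (c ◂_) (row-coefficients l)

constantForm : ℚ → Aff m
constantForm = row (λ _ → 0ℚ)

seq-constantForm : ∀ b (ρ : ℝ^ m) i → seq (⟦ constantForm b ⟧ ρ) i ≡ b
seq-constantForm {ℕ.zero}  b ρ i = refl
seq-constantForm {ℕ.suc m} b ρ i =
  trans (cong₂ ℚ._+_ (ℚ.*-zeroˡ (seq (ρ zero) i)) (seq-constantForm b (Vec.tail ρ) i)) (ℚ.+-identityˡ b)

coordinate : Fin m → Aff m
coordinate zero    = 1ℚ ◂ constantForm 0ℚ
coordinate (suc i) = 0ℚ ◂ coordinate i

seq-coordinate : ∀ j (ρ : ℝ^ m) i → seq (⟦ coordinate j ⟧ ρ) i ≡ seq (ρ j) i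
seq-coordinate zero ρ i =
  trans (cong₂ ℚ._+_ (ℚ.*-identityˡ (seq (ρ zero) i)) (seq-constantForm 0ℚ (Vec.tail ρ) i))
    (ℚ.+-identityʳ (seq (ρ zero) i))
seq-coordinate (suc j) ρ i =
  trans (cong₂ ℚ._+_ (ℚ.*-zeroˡ (seq (ρ zero) i)) (seq-coordinate j (Vec.tail ρ) i))
    (ℚ.+-identityˡ (seq (ρ (suc j)) i))

form : Term m → Aff m
form (var i)   = coordinate i
form (const c) = constantForm c
form (s ⊕ t)   = combine 1ℚ (form s) 1ℚ (form t)

seq-form : ∀ (t : Term m) ρ i → seq (⟦ form t ⟧ ρ) i ≡ seq (eval t ρ) i
seq-form (var j)   ρ i = seq-coordinate j ρ i
seq-form (const c) ρ i = seq-constantForm c ρ i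
seq-form (s ⊕ t)   ρ i = trans (seq-combine 1ℚ (form s) 1ℚ (form t) ρ i)
  (cong₂ ℚ._+_ (trans (ℚ.*-identityˡ _) (seq-form s ρ i)) (trans (ℚ.*-identityˡ _) (seq-form t ρ i)))

-- This is `l′` minus `l`, so that comparing `l` with `l′` becomes comparing 0 with the difference.
difference : Aff m → Aff m → Aff m
difference l l′ = combine 1ℚ l′ (ℚ.- 1ℚ) l

0ᴿ : ℝ
0ᴿ = fromℚ 0ℚ

same-difference : ∀ (l l′ : Aff m) ρ →
  SameOrder (⟦ l ⟧ ρ) (⟦ l′ ⟧ ρ) 0ᴿ (⟦ difference l l′ ⟧ ρ)
same-difference l l′ ρ = same-shift λ i →
  trans (cong (ℚ._- 0ℚ) (seq-combine 1ℚ l′ (ℚ.- 1ℚ) l ρ i))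
    (solve 2 (λ a b → (con 1ℚ :* b :+ con (ℚ.- 1ℚ) :* a) :- con 0ℚ := b :- a) refl
      (seq (⟦ l ⟧ ρ) i) (seq (⟦ l′ ⟧ ρ) i))

-- Made total so that every form has a threshold. A form with leading coefficient zero gets the zero
-- form as threshold, which is a harmless extra cut point.
inverse : ℚ → ℚ
inverse c with c ℚ.≟ 0ℚ
... | yes _  = 0ℚ
... | no c≢0 = (ℚ.1/ c) {{ℚ.≢-nonZero c≢0}}

*-inverse : ∀ {c} → c ≢ 0ℚ → c ℚ.* inverse c ≡ 1ℚ
*-inverse {c} c≢0 with c ℚ.≟ 0ℚ
... | yes c≡0 = contradiction c≡0 c≢0
... | no c≢0′ = ℚ.*-inverseʳ c {{ℚ.≢-nonZero c≢0′}}

rest : Aff (ℕ.suc m) → Aff m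
rest (c ◂ l) = l

-- the value of x₀ at which c x₀ + l vanishes (junk when c ≡ 0ℚ)
threshold : Aff (ℕ.suc m) → Aff m
threshold (c ◂ l) = combine (ℚ.- inverse c) l 0ℚ l

-- The right-hand side is shaped like the value of `threshold`: `d` is the inverse of `c`, and
-- `0ℚ ℚ.* r` comes from the second slot of `combine`.
cut-identity : ∀ {c d} a r → c ℚ.* d ≡ 1ℚ →
  (c ℚ.* a ℚ.+ r) ℚ.- 0ℚ ≡ c ℚ.* (a ℚ.- (ℚ.- d ℚ.* r ℚ.+ 0ℚ ℚ.* r))
cut-identity {c} {d} a r cd≡1 = begin
  (c ℚ.* a ℚ.+ r) ℚ.- 0ℚ
    ≡⟨ solve 2 (λ a r → (a :+ r) :- con 0ℚ := a :+ con 1ℚ :* r) refl (c ℚ.* a) r ⟩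
  c ℚ.* a ℚ.+ 1ℚ ℚ.* r
    ≡⟨ cong (λ e → c ℚ.* a ℚ.+ e ℚ.* r) cd≡1 ⟨
  c ℚ.* a ℚ.+ (c ℚ.* d) ℚ.* r
    ≡⟨ solve 4 (λ c d a r → c :* a :+ (c :* d) :* r := c :* (a :- (:- d :* r :+ con 0ℚ :* r))) refl c d a r ⟩
  c ℚ.* (a ℚ.- (ℚ.- d ℚ.* r ℚ.+ 0ℚ ℚ.* r)) ∎
  where open ≡-Reasoning

seq-cut : ∀ c (l : Aff m) a ρ i → c ≢ 0ℚ →
  seq (⟦ c ◂ l ⟧ (a Vec.∷ ρ)) i ℚ.- 0ℚ ≡
  c ℚ.* (seq a i ℚ.- seq (⟦ threshold (c ◂ l) ⟧ ρ) i)
seq-cut c l a ρ i c≢0 = trans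
  (cut-identity {c} {inverse c} (seq a i) (seq (⟦ l ⟧ ρ) i) (*-inverse c≢0))
  (cong (λ t → c ℚ.* (seq a i ℚ.- t)) (sym (seq-combine (ℚ.- inverse c) l 0ℚ l ρ i)))

same-sign-zero : ∀ (l : Aff m) a ρ → SameOrder 0ᴿ (⟦ l ⟧ ρ) 0ᴿ (⟦ 0ℚ ◂ l ⟧ (a Vec.∷ ρ))
same-sign-zero l a ρ = same-shift λ i → cong (ℚ._- 0ℚ) (0*a+r≡r (seq a i) (seq (⟦ l ⟧ ρ) i))
  where
  0*a+r≡r : ∀ a r → 0ℚ ℚ.* a ℚ.+ r ≡ r
  0*a+r≡r a r = trans (cong (ℚ._+ r) (ℚ.*-zeroˡ a)) (ℚ.+-identityˡ r)

same-sign-pos : ∀ c .{{_ : ℚ.Positive c}} (l : Aff m) a ρ →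
  SameOrder (⟦ threshold (c ◂ l) ⟧ ρ) a 0ᴿ (⟦ c ◂ l ⟧ (a Vec.∷ ρ))
same-sign-pos c l a ρ = same-scale c λ i → seq-cut c l a ρ i (ℚ.<⇒≢ (ℚ.positive⁻¹ c) ∘ sym)

same-sign-neg : ∀ c .{{_ : ℚ.Negative c}} (l : Aff m) a ρ →
  SameOrder a (⟦ threshold (c ◂ l) ⟧ ρ) 0ᴿ (⟦ c ◂ l ⟧ (a Vec.∷ ρ))
same-sign-neg c l a ρ = same-scale (ℚ.- c) {{ℚ.positive (ℚ.neg-antimono-< (ℚ.negative⁻¹ c))}} λ i →
  trans (seq-cut c l a ρ i (ℚ.<⇒≢ (ℚ.negative⁻¹ c))) (flip c (seq a i) (seq (⟦ threshold (c ◂ l) ⟧ ρ) i))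
  where
  flip : ∀ c a t → c ℚ.* (a ℚ.- t) ≡ ℚ.- c ℚ.* (t ℚ.- a)
  flip = solve 3 (λ c a t → c :* (a :- t) := :- c :* (t :- a)) refl

-- Agreement of signs on finite lists of forms

SameSigns : List (Aff m) → ℝ^ m → ℝ^ m → Set
SameSigns L ρ ρ′ = ∀ {l} → l ∈ₗ L → SameOrder 0ᴿ (⟦ l ⟧ ρ) 0ᴿ (⟦ l ⟧ ρ′)

SameCuts : List (Aff m) → ℝ → ℝ^ m → ℝ → ℝ^ m → Set
SameCuts T a ρ a′ ρ′ = ∀ {t} → t ∈ₗ T → SameOrder (⟦ t ⟧ ρ) a (⟦ t ⟧ ρ′) a′

-- If the leading coefficient is zero, the rest alone gives the sign; otherwise the sign tells on
-- which side of the threshold the new value lies, with sides exchanged for a negative coefficient.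
same-sign-∷ : ∀ (l : Aff (ℕ.suc m)) {a a′ ρ ρ′} →
  SameOrder 0ᴿ (⟦ rest l ⟧ ρ) 0ᴿ (⟦ rest l ⟧ ρ′) →
  SameOrder (⟦ threshold l ⟧ ρ) a (⟦ threshold l ⟧ ρ′) a′ →
  SameOrder 0ᴿ (⟦ l ⟧ (a Vec.∷ ρ)) 0ᴿ (⟦ l ⟧ (a′ Vec.∷ ρ′))
same-sign-∷ (c ◂ l) {a} {a′} {ρ} {ρ′} same-rest same-cut = by-sign (ℚ.<-cmp 0ℚ c)
  where
  by-sign : Tri (0ℚ ℚ.< c) (0ℚ ≡ c) (c ℚ.< 0ℚ) →
    SameOrder 0ᴿ (⟦ c ◂ l ⟧ (a Vec.∷ ρ)) 0ᴿ (⟦ c ◂ l ⟧ (a′ Vec.∷ ρ′))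
  by-sign (tri≈ _ refl _) =
    same-trans (same-sym (same-sign-zero l a ρ)) (same-trans same-rest (same-sign-zero l a′ ρ′))
  by-sign (tri< 0<c _ _) =
    same-trans (same-sym (same-sign-pos c l a ρ)) (same-trans same-cut (same-sign-pos c l a′ ρ′))
    where instance _ = ℚ.positive 0<c
  by-sign (tri> _ _ c<0) =
    same-trans (same-sym (same-sign-neg c l a ρ)) (same-trans (same-swap same-cut) (same-sign-neg c l a′ ρ′))
    where instance _ = ℚ.negative c<0

rests thresholds : List (Aff (ℕ.suc m)) → List (Aff m)
rests      = map rest
thresholds = map threshold

same-signs-∷ : ∀ (L : List (Aff (ℕ.suc m))) {a a′ ρ ρ′} →
  SameSigns (rests L) ρ ρ′ → SameCuts (thresholds L) a ρ a′ ρ′ →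
  SameSigns L (a Vec.∷ ρ) (a′ Vec.∷ ρ′)
same-signs-∷ L same-rests same-cuts {l} l∈L =
  same-sign-∷ l (same-rests (∈-map⁺ rest l∈L)) (same-cuts (∈-map⁺ threshold l∈L))

same-signs-sym : ∀ {L : List (Aff m)} {ρ ρ′} → SameSigns L ρ ρ′ → SameSigns L ρ′ ρ
same-signs-sym same l∈L = same-sym (same l∈L)

same-signs-cong : ∀ (L : List (Aff m)) {ρ ρ′} → ρ ≋ ρ′ → SameSigns L ρ ρ′
same-signs-cong L ρ≋ρ′ {l} _ = same-cong (≈-refl {0ᴿ}) (⟦⟧-cong l ρ≋ρ′)

-- The rests settle the forms with leading coefficient zero; the differences settle how the cut
-- points are ordered, ties included.
eliminate : List (Aff (ℕ.suc m)) → List (Aff m)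
eliminate L = rests L ++ cartesianProductWith difference (thresholds L) (thresholds L)

-- A finite list of affine forms whose signs decide the formula.
signs : Formula m → List (Aff m)
signs (s ≐ t)   = difference (form s) (form t) ∷ []
signs (s ≼ t)   = difference (form s) (form t) ∷ []
signs (not φ)   = signs φ
signs (φ and ψ) = signs φ ++ signs ψ
signs (φ or ψ)  = signs φ ++ signs ψ
signs (φ ⇒ ψ)   = signs φ ++ signs ψ
signs (all φ)   = eliminate (signs φ)
signs (ex φ)    = eliminate (signs φ)

same-eval : ∀ (s t : Term m) {ρ ρ′} → SameSigns (difference (form s) (form t) ∷ []) ρ ρ′ →
  SameOrder (eval s ρ) (eval t ρ) (eval s ρ′) (eval t ρ′)
same-eval s t {ρ} {ρ′} same =
  same-trans (translate ρ) (same-trans (same (here refl)) (same-sym (translate ρ′)))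
  where
  translate : ∀ ρ → SameOrder (eval s ρ) (eval t ρ) 0ᴿ (⟦ difference (form s) (form t) ⟧ ρ)
  translate ρ = same-trans
    (same-shift λ i → cong₂ ℚ._-_ (seq-form t ρ i) (seq-form s ρ i))
    (same-difference (form s) (form t) ρ)

-- Consequences of excluded middle

module Classical (em : ExcludedMiddle 0ℓ) where

  -- If `y` exceeds `x` by at least a fixed `ε` at arbitrarily late indices, the Cauchy property
  -- makes `x` smaller at all late indices. If there is no such `ε`, then `y ⊑ x`, against the
  -- hypothesis.
  ⊏⇒⊑ : ∀ {x y} → x ⊏ y → x ⊑ y
  ⊏⇒⊑ {x} {y} x<y with em {∃ λ ε → 0ℚ ℚ.< ε × ∀ N → ∃ λ i → N ℕ.≤ i × ¬ (seq y i ℚ.< seq x i ℚ.+ ε)}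
  ... | no none = contradiction (mk⊑ y≤x) x<y
    where
    y≤x : y ≤ᴿ x
    y≤x ε 0<ε with em {∃ λ N → ∀ i → N ℕ.≤ i → seq y i ℚ.< seq x i ℚ.+ ε}
    ... | yes p = p
    ... | no ¬p = ⊥-elim (none (ε , 0<ε , λ N → late N em))
      where
      late : ∀ N → Dec (∃ λ i → N ℕ.≤ i × ¬ (seq y i ℚ.< seq x i ℚ.+ ε)) →
             ∃ λ i → N ℕ.≤ i × ¬ (seq y i ℚ.< seq x i ℚ.+ ε)
      late N (yes p) = p
      late N (no ¬i) = ⊥-elim (¬p (N , λ i N≤i → ℚ.≰⇒> λ le → ¬i (i , N≤i , λ lt → ℚ.<-irrefl refl (ℚ.<-≤-trans lt le))))
  ... | yes (ε , 0<ε , late) = mk⊑ λ δ 0<δ →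
    -- Each sequence may move by less than `ε / 2` away from the late index `j`, where the gap is at
    -- least `ε`, so the gap never closes.
    let M , p = cauchy x (½ ℚ.* ε) (0<½* 0<ε)
        N , r = cauchy y (½ ℚ.* ε) (0<½* 0<ε)
        j , MN≤j , x+ε≤y = late (M ℕ.⊔ N)
    in M ℕ.⊔ N , λ i MN≤i →
       ℚ.<-trans
         (eventually (seq x i) (seq y i) (seq x j) (seq y j) (ℚ.≮⇒≥ x+ε≤y)
           (p i j (ℕ.m⊔n≤o⇒m≤o M N MN≤i) (ℕ.m⊔n≤o⇒m≤o M N MN≤j))
           (r j i (ℕ.m⊔n≤o⇒n≤o M N MN≤j) (ℕ.m⊔n≤o⇒n≤o M N MN≤i)))
         (subst (ℚ._< seq y i ℚ.+ δ) (ℚ.+-identityʳ (seq y i)) (ℚ.+-monoʳ-< (seq y i) 0<δ))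
    where
    eventually : ∀ a b c d → c ℚ.+ ε ℚ.≤ d → ℚ.∣ a ℚ.- c ∣ ℚ.< ½ ℚ.* ε → ℚ.∣ d ℚ.- b ∣ ℚ.< ½ ℚ.* ε → a ℚ.< b
    eventually a b c d c+ε≤d a-c d-b = begin-strict
      a                                          <⟨ a-b<c⇒a<b+c a-c ⟩
      c ℚ.+ ½ ℚ.* ε                              ≡⟨ solve 2 (λ c e → c :+ con ½ :* e := c :+ e :- con ½ :* e) refl c ε ⟩
      c ℚ.+ ε ℚ.- ½ ℚ.* ε                        ≤⟨ ℚ.+-monoˡ-≤ (ℚ.- (½ ℚ.* ε)) c+ε≤d ⟩
      d ℚ.- ½ ℚ.* ε                              <⟨ ℚ.+-monoˡ-< (ℚ.- (½ ℚ.* ε)) (a-b<c⇒a<b+c {d} {b} d-b) ⟩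
      b ℚ.+ ½ ℚ.* ε ℚ.- ½ ℚ.* ε                  ≡⟨ solve 2 (λ b e → b :+ e :- e := b) refl b (½ ℚ.* ε) ⟩
      b                                          ∎
      where open ℚ.≤-Reasoning

  ⊏-or-⊒ : ∀ x y → x ⊏ y ⊎ y ⊑ x
  ⊏-or-⊒ x y with em {y ⊑ x}
  ... | yes y≤x = inj₂ y≤x
  ... | no  x<y = inj₁ x<y

  ⊏-trans : ∀ {x y z} → x ⊏ y → y ⊏ z → x ⊏ z
  ⊏-trans x<y y<z = ⊏-⊑-trans x<y (⊏⇒⊑ y<z)

  ⊑-⊏-trans : ∀ {x y z} → x ⊑ y → y ⊏ z → x ⊏ z
  ⊑-⊏-trans x≤y y<z z≤x = y<z (⊑-trans z≤x x≤y)

  same-⊏ : ∀ {x y x′ y′} → x ⊏ y → x′ ⊏ y′ → SameOrder x y x′ y′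
  same-⊏ x<y x′<y′ = mkSame
    (mk⇔ (λ _ → ⊏⇒⊑ x′<y′) (λ _ → ⊏⇒⊑ x<y))
    (mk⇔ (λ y≤x → contradiction y≤x x<y) (λ y′≤x′ → contradiction y′≤x′ x′<y′))

  -- Points in prescribed position relative to finite lists

  strictLowerBound : (B : List ℝ) → ∃ λ x → ∀ {w} → w ∈ₗ B → x ⊏ w
  strictLowerBound [] = 0ᴿ , λ ()
  strictLowerBound (w ∷ B) with strictLowerBound B
  ... | x , x<B with ⊏-or-⊒ x w
  ...   | inj₁ x<w = x , λ { (here refl) → x<w ; (there v∈B) → x<B v∈B }
  ...   | inj₂ w≤x = w +ᴿ fromℚ (ℚ.- 1ℚ) , λ
          { (here refl) → -1⊏ w
          ; (there v∈B) → ⊏-trans (⊏-⊑-trans (-1⊏ w) w≤x) (x<B v∈B) }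

  -- The point is the maximum of `x` and the entries of `A`; starting from `x` gives the empty list
  -- a maximum too. The last component expresses that the maximum is attained.
  leastUpperBound : ∀ x (A : List ℝ) → ∃ λ y →
    x ⊑ y × (∀ {u} → u ∈ₗ A → u ⊑ y) × (∀ {z} → x ⊏ z → (∀ {u} → u ∈ₗ A → u ⊏ z) → y ⊏ z)
  leastUpperBound x [] = x , ⊑-refl , (λ ()) , λ x<z _ → x<z
  leastUpperBound x (u ∷ A) with leastUpperBound x A
  ... | y , x≤y , A≤y , least with ⊏-or-⊒ y u
  ...   | inj₁ y<u = u , ⊑-trans x≤y (⊏⇒⊑ y<u)
          , (λ { (here refl) → ⊑-refl ; (there v∈A) → ⊑-trans (A≤y v∈A) (⊏⇒⊑ y<u) })
          , λ _ A<z → A<z (here refl)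
  ...   | inj₂ u≤y = y , x≤y , (λ { (here refl) → u≤y ; (there v∈A) → A≤y v∈A })
          , λ x<z A<z → least x<z (A<z ∘ there)

  -- Whenever the point found so far is not below the next entry, it is replaced by the midpoint of
  -- `x` and that entry, which is smaller still.
  justAbove : ∀ x (B : List ℝ) → (∀ {w} → w ∈ₗ B → x ⊏ w) →
    ∃ λ y → x ⊏ y × (∀ {w} → w ∈ₗ B → y ⊏ w)
  justAbove x [] _ = x +ᴿ fromℚ 1ℚ , ⊏+1 x , λ ()
  justAbove x (w ∷ B) x<B with justAbove x B (x<B ∘ there)
  ... | y , x<y , y<B with ⊏-or-⊒ y w
  ...   | inj₁ y<w = y , x<y , λ { (here refl) → y<w ; (there v∈B) → y<B v∈B }
  ...   | inj₂ w≤y = midpoint x w , ⊏-midpoint x<w , λ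
          { (here refl) → midpoint-⊏ x<w
          ; (there v∈B) → ⊏-trans (⊏-⊑-trans (midpoint-⊏ x<w) w≤y) (y<B v∈B) }
    where
    x<w : x ⊏ w
    x<w = x<B (here refl)

  between : (A B : List ℝ) → (∀ {u w} → u ∈ₗ A → w ∈ₗ B → u ⊏ w) →
    ∃ λ y → (∀ {u} → u ∈ₗ A → u ⊏ y) × (∀ {w} → w ∈ₗ B → y ⊏ w)
  between A B A<B =
    -- The base point `x` lies below `B`, so the maximum of `x` and `A` stays below `B` even when
    -- `A` is empty.
    let x , x<B = strictLowerBound B
        s , _ , A≤s , least = leastUpperBound x A
        y , s<y , y<B = justAbove s B λ w∈B → least (x<B w∈B) λ u∈A → A<B u∈A w∈B
    in y , (λ u∈A → ⊑-⊏-trans (A≤s u∈A) s<y) , y<B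

  -- E lists further lower bounds that the new point has to respect.
  place : (T : List (Aff m)) (E : List ℝ) {ρ ρ′ : ℝ^ m} {a : ℝ} →
    (∀ {t u} → t ∈ₗ T → u ∈ₗ T → SameOrder (⟦ t ⟧ ρ) (⟦ u ⟧ ρ) (⟦ t ⟧ ρ′) (⟦ u ⟧ ρ′)) →
    (∀ {t} → t ∈ₗ T → ¬ ⟦ t ⟧ ρ ≈ a) →
    (∀ {e t} → e ∈ₗ E → t ∈ₗ T → a ⊏ ⟦ t ⟧ ρ → e ⊏ ⟦ t ⟧ ρ′) →
    ∃ λ a′ → SameCuts T a ρ a′ ρ′ × (∀ {e} → e ∈ₗ E → e ⊏ a′)
  place T E {ρ} {ρ′} {a} same apart E<B =
    let a′ , A<a′ , a′<B = between (E ++ map v′ below) (map v′ above) A<B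
    in a′ , cuts A<a′ a′<B , λ e∈E → A<a′ (∈-++⁺ˡ e∈E)
    where
    v v′ : Aff _ → ℝ
    v  t = ⟦ t ⟧ ρ
    v′ t = ⟦ t ⟧ ρ′

    below? = λ t → em {v t ⊏ a}
    above? = λ t → em {a ⊏ v t}
    below = filter below? T
    above = filter above? T

    A<B : ∀ {u w} → u ∈ₗ E ++ map v′ below → w ∈ₗ map v′ above → u ⊏ w
    A<B u∈A w∈B with ∈-map⁻ v′ w∈B
    ... | t , t∈above , refl with ∈-filter⁻ above? {xs = T} t∈above | ∈-++⁻ E u∈A
    ...   | t∈T , a<t | inj₁ u∈E = E<B u∈E t∈T a<t
    ...   | t∈T , a<t | inj₂ u∈A′ with ∈-map⁻ v′ u∈A′
    ...     | s , s∈below , refl with ∈-filter⁻ below? {xs = T} s∈below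
    -- Over `ρ` the point `a` separates the two thresholds, and their order carries over to `ρ′`.
    ...       | s∈T , s<a = ⊏-trans s<a a<t ∘ from (same-≥ (same s∈T t∈T))

    cuts : ∀ {a′} → (∀ {u} → u ∈ₗ E ++ map v′ below → u ⊏ a′) →
           (∀ {w} → w ∈ₗ map v′ above → a′ ⊏ w) → SameCuts T a ρ a′ ρ′
    cuts A<a′ a′<B {t} t∈T with ⊏-or-⊒ (v t) a | ⊏-or-⊒ a (v t)
    ... | inj₁ t<a | _ = same-⊏ t<a (A<a′ (∈-++⁺ʳ E (∈-map⁺ v′ (∈-filter⁺ below? t∈T t<a))))
    ... | inj₂ _ | inj₁ a<t = same-swap (same-⊏ a<t (a′<B (∈-map⁺ v′ (∈-filter⁺ above? t∈T a<t))))
    ... | inj₂ a≤t | inj₂ t≤a = contradiction (⊑-antisym t≤a a≤t) (apart t∈T)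

  -- The "forth" step of a back-and-forth argument.
  extend : (L : List (Aff (ℕ.suc m))) {ρ ρ′ : ℝ^ m} → SameSigns (eliminate L) ρ ρ′ →
    ∀ a → ∃ λ a′ → SameSigns L (a Vec.∷ ρ) (a′ Vec.∷ ρ′)
  extend L {ρ} {ρ′} same a = choose em
    where
    T = thresholds L

    same-rests : SameSigns (rests L) ρ ρ′
    same-rests l∈ = same (∈-++⁺ˡ l∈)

    same-T : ∀ {t u} → t ∈ₗ T → u ∈ₗ T → SameOrder (⟦ t ⟧ ρ) (⟦ u ⟧ ρ) (⟦ t ⟧ ρ′) (⟦ u ⟧ ρ′)
    same-T {t} {u} t∈T u∈T = same-trans (same-difference t u ρ)
      (same-trans (same (∈-++⁺ʳ (rests L) (∈-cartesianProductWith⁺ difference t∈T u∈T)))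
        (same-sym (same-difference t u ρ′)))

    choose : Dec (∃ λ t → t ∈ₗ T × ⟦ t ⟧ ρ ≈ a) → ∃ λ a′ → SameSigns L (a Vec.∷ ρ) (a′ Vec.∷ ρ′)
    -- A value on a threshold is matched by the value of the same threshold over `ρ′`; any other
    -- value lies in an open gap and is left to `place`.
    choose (yes (u , u∈T , u≈a)) = ⟦ u ⟧ ρ′ , same-signs-∷ L same-rests λ {t} t∈T →
      same-trans (same-cong (≈-refl {⟦ t ⟧ ρ}) (≈-sym {⟦ u ⟧ ρ} {a} u≈a)) (same-T t∈T u∈T)
    choose (no none) =
      let a′ , same-cuts , _ = place T [] same-T (λ t∈T t≈a → none (_ , t∈T , t≈a)) λ ()
      in a′ , same-signs-∷ L same-rests same-cuts

  -- Induction on the formula. Agreement of signs is symmetric, which handles negation and the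
  -- premise of an implication; at a quantifier `extend` supplies the matching value, going from
  -- `ρ′` back to `ρ` in the universal case.
  ⊨-same : ∀ (φ : Formula m) {ρ ρ′} → SameSigns (signs φ) ρ ρ′ → ρ ⊨ φ → ρ′ ⊨ φ
  ⊨-same (s ≐ t) same s≈t = same-≈ (same-eval s t same) s≈t
  ⊨-same (s ≼ t) same s≤t = un⊑ (to (same-≤ (same-eval s t same)) (mk⊑ s≤t))
  ⊨-same (not φ) same ¬φ = ¬φ ∘ ⊨-same φ (same-signs-sym {L = signs φ} same)
  ⊨-same (φ and ψ) same (p , r) =
    ⊨-same φ (same ∘ ∈-++⁺ˡ) p , ⊨-same ψ (same ∘ ∈-++⁺ʳ (signs φ)) r
  ⊨-same (φ or ψ) same (inj₁ p) = inj₁ (⊨-same φ (same ∘ ∈-++⁺ˡ) p)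
  ⊨-same (φ or ψ) same (inj₂ r) = inj₂ (⊨-same ψ (same ∘ ∈-++⁺ʳ (signs φ)) r)
  ⊨-same (φ ⇒ ψ) same φ⇒ψ p = ⊨-same ψ (same ∘ ∈-++⁺ʳ (signs φ))
    (φ⇒ψ (⊨-same φ (same-signs-sym {L = signs φ} (same ∘ ∈-++⁺ˡ)) p))
  ⊨-same (all φ) same p a′ =
    let a , same′ = extend (signs φ) (same-signs-sym {L = signs (all φ)} same) a′
    in ⊨-same φ (same-signs-sym {L = signs φ} same′) (p a)
  ⊨-same (ex φ) same (a , p) =
    let a′ , same′ = extend (signs φ) same a in a′ , ⊨-same φ same′ p

  -- Equal points give every form the same sign, so this is an instance of `⊨-same`.
  ⊨-resp : ∀ (φ : Formula m) {ρ ρ′} → ρ ≋ ρ′ → ρ ⊨ φ → ρ′ ⊨ φ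
  ⊨-resp φ ρ≋ρ′ = ⊨-same φ (same-signs-cong (signs φ) ρ≋ρ′)

  -- A solution that is no threshold could be increased without changing any sign.
  unique⇒threshold : ∀ (ψ : Formula (ℕ.suc m)) {y x} → (y Vec.∷ x) ⊨ ψ →
    (∀ z → (z Vec.∷ x) ⊨ ψ → z ≈ y) →
    ∃ λ t → t ∈ₗ thresholds (signs ψ) × ⟦ t ⟧ x ≈ y
  unique⇒threshold ψ {y} {x} y⊨ψ unique = search em
    where
    T = thresholds (signs ψ)

    search : Dec (∃ λ t → t ∈ₗ T × ⟦ t ⟧ x ≈ y) → ∃ λ t → t ∈ₗ T × ⟦ t ⟧ x ≈ y
    search (yes found) = found
    search (no none) =
      -- Both points lie over the same `x`, and `y` is passed as an extra strict lower bound, so the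
      -- new solution differs from `y`.
      let z , same-cuts , y<z = place T (y ∷ [])
            (λ {t} {u} _ _ → same-cong (≈-refl {⟦ t ⟧ x}) (≈-refl {⟦ u ⟧ x}))
            (λ t∈T t≈y → none (_ , t∈T , t≈y))
            λ { (here refl) _ y<t → y<t }
          z⊨ψ = ⊨-same ψ
            (same-signs-∷ (signs ψ) (same-signs-cong (rests (signs ψ)) λ i → ≈-refl {x i}) same-cuts) y⊨ψ
      in contradiction (≈⇒⊑ (unique z z⊨ψ)) (y<z (here refl))

-- Constructions on formulas

lift↑ : (Fin m → Fin k) → Fin (ℕ.suc m) → Fin (ℕ.suc k)
lift↑ g zero    = zero
lift↑ g (suc i) = suc (g i)

renᵗ : (Fin m → Fin k) → Term m → Term k
renᵗ g (var i)   = var (g i)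
renᵗ g (const c) = const c
renᵗ g (s ⊕ t)   = renᵗ g s ⊕ renᵗ g t

ren : (Fin m → Fin k) → Formula m → Formula k
ren g (s ≐ t)   = renᵗ g s ≐ renᵗ g t
ren g (s ≼ t)   = renᵗ g s ≼ renᵗ g t
ren g (not φ)   = not ren g φ
ren g (φ and ψ) = ren g φ and ren g ψ
ren g (φ or ψ)  = ren g φ or ren g ψ
ren g (φ ⇒ ψ)   = ren g φ ⇒ ren g ψ
ren g (all φ)   = all ren (lift↑ g) φ
ren g (ex φ)    = ex ren (lift↑ g) φ

eval-ren : ∀ (g : Fin m → Fin k) t {ρ ρ′} → (∀ i → ρ (g i) ≡ ρ′ i) →
  eval (renᵗ g t) ρ ≡ eval t ρ′
eval-ren g (var i)   eq = eq i
eval-ren g (const c) eq = refl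
eval-ren g (s ⊕ t)   eq = cong₂ _+ᴿ_ (eval-ren g s eq) (eval-ren g t eq)

-- Environments are matched entrywise by `_≡_`: this passes under a binder by `refl` and makes the
-- values of terms identical, so truth transfers by substitution.
⊨-ren : ∀ (g : Fin m → Fin k) φ {ρ ρ′} → (∀ i → ρ (g i) ≡ ρ′ i) →
  ρ ⊨ ren g φ ⇔ ρ′ ⊨ φ
⊨-ren g (s ≐ t) eq = mk⇔
  (subst₂ _≈_ (eval-ren g s eq) (eval-ren g t eq))
  (subst₂ _≈_ (sym (eval-ren g s eq)) (sym (eval-ren g t eq)))
⊨-ren g (s ≼ t) eq = mk⇔
  (subst₂ _≤ᴿ_ (eval-ren g s eq) (eval-ren g t eq))
  (subst₂ _≤ᴿ_ (sym (eval-ren g s eq)) (sym (eval-ren g t eq)))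
⊨-ren g (not φ) eq = mk⇔ (_∘ from (⊨-ren g φ eq)) (_∘ to (⊨-ren g φ eq))
⊨-ren g (φ and ψ) eq = mk⇔
  (λ (p , r) → to (⊨-ren g φ eq) p , to (⊨-ren g ψ eq) r)
  (λ (p , r) → from (⊨-ren g φ eq) p , from (⊨-ren g ψ eq) r)
⊨-ren g (φ or ψ) eq = mk⇔
  (Sum.map (to (⊨-ren g φ eq)) (to (⊨-ren g ψ eq)))
  (Sum.map (from (⊨-ren g φ eq)) (from (⊨-ren g ψ eq)))
⊨-ren g (φ ⇒ ψ) eq = mk⇔
  (λ p → to (⊨-ren g ψ eq) ∘ p ∘ from (⊨-ren g φ eq))
  (λ p → from (⊨-ren g ψ eq) ∘ p ∘ to (⊨-ren g φ eq))
⊨-ren g (all φ) eq = mk⇔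
  (λ p a → to (⊨-ren (lift↑ g) φ λ { zero → refl ; (suc i) → eq i }) (p a))
  (λ p a → from (⊨-ren (lift↑ g) φ λ { zero → refl ; (suc i) → eq i }) (p a))
⊨-ren g (ex φ) eq = mk⇔
  (λ (a , p) → a , to (⊨-ren (lift↑ g) φ λ { zero → refl ; (suc i) → eq i }) p)
  (λ (a , p) → a , from (⊨-ren (lift↑ g) φ λ { zero → refl ; (suc i) → eq i }) p)

-- The syntax has no truth constants; a trivial equation serves as the empty conjunction and its
-- negation as the empty disjunction.
⋀ : (Fin k → Formula m) → Formula m
⋀ {ℕ.zero}  φ = const 0ℚ ≐ const 0ℚ
⋀ {ℕ.suc k} φ = φ zero and ⋀ (φ ∘ suc)

⊨-⋀ : ∀ (φ : Fin k → Formula m) ρ → ρ ⊨ ⋀ φ ⇔ (∀ i → ρ ⊨ φ i)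
⊨-⋀ {ℕ.zero}  φ ρ = mk⇔ (λ _ ()) (λ _ → ≈-refl {0ᴿ})
⊨-⋀ {ℕ.suc k} φ ρ = mk⇔
  (λ { (p , r) zero → p ; (p , r) (suc i) → to (⊨-⋀ (φ ∘ suc) ρ) r i })
  (λ p → p zero , from (⊨-⋀ (φ ∘ suc) ρ) (p ∘ suc))

⋁ : (Fin k → Formula m) → Formula m
⋁ {ℕ.zero}  φ = not (const 0ℚ ≐ const 0ℚ)
⋁ {ℕ.suc k} φ = φ zero or ⋁ (φ ∘ suc)

⊨-⋁ : ∀ (φ : Fin k → Formula m) {ρ} → ρ ⊨ ⋁ φ ⇔ (∃ λ i → ρ ⊨ φ i)
⊨-⋁ {ℕ.zero}  φ = mk⇔ (λ p → contradiction (≈-refl {0ᴿ}) p) (λ ())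
⊨-⋁ {ℕ.suc k} φ = mk⇔
  (λ { (inj₁ p) → zero , p ; (inj₂ r) → let i , p = to (⊨-⋁ (φ ∘ suc)) r in suc i , p })
  (λ { (zero , p) → inj₁ p ; (suc i , p) → inj₂ (from (⊨-⋁ (φ ∘ suc)) (i , p)) })

-- Clearing denominators

-- The second field of `mkℚ` is the denominator minus one. Giving lowest terms directly lets
-- numerator and denominator compute.
fromℤ : ℤ.ℤ → ℚ
fromℤ z = mkℚ z 0 (Coprimality.sym (1-coprimeTo ℤ.∣ z ∣))

fromℕ : ℕ → ℚ
fromℕ a = fromℤ (+ a)

fromℕ-suc : ∀ a → fromℕ (ℕ.suc a) ≡ 1ℚ ℚ.+ fromℕ a
fromℕ-suc a = ℚ.toℚᵘ-injective (ℚᵘ.≃-trans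
  (ℚᵘ.*≡* (cong (λ z → (+ 1 ℤ.+ z) ℤ.* + 1) (sym (ℤ.*-identityʳ (+ a)))))
  (ℚᵘ.≃-sym (ℚ.toℚᵘ-homo-+ 1ℚ (fromℕ a))))

fromℕ-* : ∀ a b → fromℕ (a ℕ.* b) ≡ fromℕ a ℚ.* fromℕ b
fromℕ-* a b = ℚ.toℚᵘ-injective (ℚᵘ.≃-trans
  (ℚᵘ.*≡* (cong (ℤ._* + 1) (ℤ.pos-* a b)))
  (ℚᵘ.≃-sym (ℚ.toℚᵘ-homo-* (fromℕ a) (fromℕ b))))

denominator-* : ∀ c → fromℕ (ℚ.↧ₙ c) ℚ.* c ≡ fromℤ (ℚ.↥ c)
denominator-* c@(mkℚ z d _) = ℚ.toℚᵘ-injective (ℚᵘ.≃-trans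
  (ℚ.toℚᵘ-homo-* (fromℕ (ℕ.suc d)) c)
  (ℚᵘ.*≡* (begin
    (+ ℕ.suc d ℤ.* z) ℤ.* + 1      ≡⟨ ℤ.*-identityʳ (+ ℕ.suc d ℤ.* z) ⟩
    + ℕ.suc d ℤ.* z                ≡⟨ ℤ.*-comm (+ ℕ.suc d) z ⟩
    z ℤ.* + ℕ.suc d                ≡⟨ cong (λ e → z ℤ.* + e) (ℕ.*-identityˡ (ℕ.suc d)) ⟨
    z ℤ.* + (1 ℕ.* ℕ.suc d)        ∎)))
  where open ≡-Reasoning

-- Terms can be added but not negated, so the integer numerator is presented as a difference of
-- naturals, each of which becomes a repeated sum.
clear-denominator : ∀ c → ∃ λ d → ∃ λ a → ∃ λ b →
  fromℕ (ℕ.suc d) ℚ.* c ≡ fromℕ a ℚ.- fromℕ b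
clear-denominator c@(mkℚ (+ a) d _) = d , a , 0 ,
  trans (denominator-* c) (sym (ℚ.+-identityʳ (fromℕ a)))
clear-denominator c@(mkℚ -[1+ b ] d _) = d , 0 , ℕ.suc b ,
  trans (denominator-* c) (sym (ℚ.+-identityˡ (fromℤ -[1+ b ])))

multiple : ℕ → Term m → Term m
multiple ℕ.zero    t = const 0ℚ
multiple (ℕ.suc a) t = t ⊕ multiple a t

seq-multiple : ∀ a (t : Term m) ρ i → seq (eval (multiple a t) ρ) i ≡ fromℕ a ℚ.* seq (eval t ρ) i
seq-multiple ℕ.zero    t ρ i = sym (ℚ.*-zeroˡ (seq (eval t ρ) i))
seq-multiple (ℕ.suc a) t ρ i =
  distrib {fromℕ (ℕ.suc a)} {fromℕ a} {seq (eval t ρ) i} (fromℕ-suc a) (seq-multiple a t ρ i)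
  where
  distrib : ∀ {p r x y} → p ≡ 1ℚ ℚ.+ r → y ≡ r ℚ.* x → x ℚ.+ y ≡ p ℚ.* x
  distrib {r = r} {x} refl refl = solve 2 (λ r x → x :+ r :* x := (con 1ℚ :+ r) :* x) refl r x

-- Terms have no rational coefficients, so only a multiple of an affine form is
-- a difference of two terms.
clear : ∀ (l : Aff k) (g : Fin k → Fin m) → ∃ λ d → ∃ λ s → ∃ λ t → ∀ ρ i →
  fromℕ (ℕ.suc d) ℚ.* seq (⟦ l ⟧ (ρ ∘ g)) i ≡ seq (eval s ρ) i ℚ.- seq (eval t ρ) i
clear (cst b) g = 0 , const b , const 0ℚ , λ ρ i →
  trans (ℚ.*-identityˡ b) (sym (ℚ.+-identityʳ b))
clear (c ◂ l) g with clear l (g ∘ suc) | clear-denominator c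
... | d , s , t , s-t | e , a , b , a-b =
  -- The successor of this number computes to `ℕ.suc d ℕ.* ℕ.suc e`, the product of both
  -- multipliers.
  e ℕ.+ d ℕ.* ℕ.suc e ,
  multiple (ℕ.suc e) s ⊕ multiple (ℕ.suc d) (multiple a (var (g zero))) ,
  multiple (ℕ.suc e) t ⊕ multiple (ℕ.suc d) (multiple b (var (g zero))) ,
  λ ρ i → scale {fromℕ (ℕ.suc d)} {fromℕ (ℕ.suc e)} {_} {fromℕ a} {fromℕ b} {seq (ρ (g zero)) i}
    {seq (⟦ l ⟧ (ρ ∘ g ∘ suc)) i} {seq (eval s ρ) i} {seq (eval t ρ) i}
    (fromℕ-* (ℕ.suc d) (ℕ.suc e)) a-b (s-t ρ i)
    (seq-multiple (ℕ.suc e) s ρ i) (twice a ρ i)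
    (seq-multiple (ℕ.suc e) t ρ i) (twice b ρ i)
  where
  twice : ∀ a ρ i → seq (eval (multiple (ℕ.suc d) (multiple a (var (g zero)))) ρ) i ≡
    fromℕ (ℕ.suc d) ℚ.* (fromℕ a ℚ.* seq (ρ (g zero)) i)
  twice a ρ i = trans (seq-multiple (ℕ.suc d) (multiple a (var (g zero))) ρ i)
    (cong (fromℕ (ℕ.suc d) ℚ.*_) (seq-multiple a (var (g zero)) ρ i))

  scale : ∀ {D E F A B x y S T s′ xa t′ xb} →
    F ≡ D ℚ.* E → E ℚ.* c ≡ A ℚ.- B → D ℚ.* y ≡ S ℚ.- T →
    s′ ≡ E ℚ.* S → xa ≡ D ℚ.* (A ℚ.* x) → t′ ≡ E ℚ.* T → xb ≡ D ℚ.* (B ℚ.* x) →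
    F ℚ.* (c ℚ.* x ℚ.+ y) ≡ (s′ ℚ.+ xa) ℚ.- (t′ ℚ.+ xb)
  scale {D} {E} {_} {A} {B} {x} {y} {S} {T} refl Ec Dy refl refl refl refl = begin
    D ℚ.* E ℚ.* (c ℚ.* x ℚ.+ y)
      ≡⟨ solve 5 (λ D E c x y → D :* E :* (c :* x :+ y) := D :* ((E :* c) :* x) :+ E :* (D :* y)) refl D E c x y ⟩
    D ℚ.* ((E ℚ.* c) ℚ.* x) ℚ.+ E ℚ.* (D ℚ.* y)
      ≡⟨ cong₂ (λ u v → D ℚ.* (u ℚ.* x) ℚ.+ E ℚ.* v) Ec Dy ⟩
    D ℚ.* ((A ℚ.- B) ℚ.* x) ℚ.+ E ℚ.* (S ℚ.- T)
      ≡⟨ solve 7 (λ D E A B x S T → D :* ((A :- B) :* x) :+ E :* (S :- T) :=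
           (E :* S :+ D :* (A :* x)) :- (E :* T :+ D :* (B :* x))) refl D E A B x S T ⟩
    (E ℚ.* S ℚ.+ D ℚ.* (A ℚ.* x)) ℚ.- (E ℚ.* T ℚ.+ D ℚ.* (B ℚ.* x)) ∎
    where open ≡-Reasoning

-- With `d + 1` times `l` equal to `s - t`, the subtraction is avoided by moving `t` to the other
-- side.
equals : Fin m → (Fin k → Fin m) → Aff k → Formula m
equals j g l = let d , s , t , _ = clear l g in (multiple (ℕ.suc d) (var j) ⊕ t) ≐ s

⊨-equals : ∀ j (g : Fin k → Fin m) l ρ → ρ ⊨ equals j g l ⇔ ρ j ≈ ⟦ l ⟧ (ρ ∘ g)
⊨-equals j g l ρ with clear l g
... | d , s , t , s-t = mk⇔ (same-≈ (same-sym same)) (same-≈ same)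
  where
  same : SameOrder (ρ j) (⟦ l ⟧ (ρ ∘ g)) (eval (multiple (ℕ.suc d) (var j) ⊕ t) ρ) (eval s ρ)
  same = same-scale (fromℕ (ℕ.suc d)) λ i →
    shift {fromℕ (ℕ.suc d)} {seq (ρ j) i} {seq (⟦ l ⟧ (ρ ∘ g)) i} {seq (eval s ρ) i} {seq (eval t ρ) i}
      (seq-multiple (ℕ.suc d) (var j) ρ i) (s-t ρ i)
    where
    shift : ∀ {D x y S T Dx} → Dx ≡ D ℚ.* x → D ℚ.* y ≡ S ℚ.- T →
      S ℚ.- (Dx ℚ.+ T) ≡ D ℚ.* (y ℚ.- x)
    shift {D} {x} {y} {S} {T} refl Dy = begin
      S ℚ.- (D ℚ.* x ℚ.+ T)      ≡⟨ solve 3 (λ S T u → S :- (u :+ T) := (S :- T) :- u) refl S T (D ℚ.* x) ⟩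
      (S ℚ.- T) ℚ.- D ℚ.* x      ≡⟨ cong (ℚ._- D ℚ.* x) Dy ⟨
      D ℚ.* y ℚ.- D ℚ.* x        ≡⟨ solve 3 (λ D x y → D :* y :- D :* x := D :* (y :- x)) refl D x y ⟩
      D ℚ.* (y ℚ.- x)            ∎
      where open ≡-Reasoning

-- Blocks of variables and finite choices

exs : ∀ q → Formula (q ℕ.+ m) → Formula m
exs ℕ.zero    φ = φ
exs (ℕ.suc q) φ = exs q (ex φ)

-- From the order (x , y) of the variables of a graph to the order (y , ρ),
-- where g picks x out of ρ.
rotate : ∀ n → (Fin n → Fin k) → Fin (n ℕ.+ q) → Fin (q ℕ.+ k)
rotate {k} {q} n g i = [ (λ j → q ↑ʳ g j) , _↑ˡ k ]′ (splitAt n i)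

lookup-rotate : ∀ n (g : Fin n → Fin k) (y : ℝ^ q) (ρ : ℝ^ k) i →
  (y Vec.++ ρ) (rotate n g i) ≡ ((ρ ∘ g) Vec.++ y) i
lookup-rotate n g y ρ i with splitAt n i
... | inj₁ j = lookup-++ʳ y ρ (g j)
... | inj₂ j = lookup-++ˡ y ρ j

choices : {A : Set} → (Fin q → List A) → List (Vector A q)
choices {ℕ.zero}  T = (λ ()) ∷ []
choices {ℕ.suc q} T = cartesianProductWith Vec._∷_ (T zero) (choices (T ∘ suc))

-- List membership means propositional equality, and vectors are functions; hence the chosen vector
-- is assembled by `Vec._∷_`, as the entries of `choices` are.
choose : {A : Set} (T : Fin q → List A) (P : Fin q → A → Set) →
  (∀ i → ∃ λ a → a ∈ₗ T i × P i a) → ∃ λ as → as ∈ₗ choices T × (∀ i → P i (as i))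
choose {ℕ.zero}  T P p = (λ ()) , here refl , λ ()
choose {ℕ.suc q} T P p =
  let a , a∈ , Pa = p zero
      as , as∈ , Pas = choose (T ∘ suc) (P ∘ suc) (p ∘ suc)
  in a Vec.∷ as , ∈-cartesianProductWith⁺ Vec._∷_ a∈ as∈ , λ { zero → Pa ; (suc i) → Pas i }

module Piecewise {ℓ} (emℓ : ExcludedMiddle ℓ) where

  -- Formulas are interpreted at level `0ℓ`, so the principle is brought down from level `ℓ` by
  -- lifting propositions.
  em : ExcludedMiddle 0ℓ
  em {P} = map′ lower lift (emℓ {Lift ℓ P})

  open Classical em

  -- Peeling off one quantifier splits `y` into head and tail. The two resulting environments agree
  -- only entrywise, which `⊨-resp` bridges.
  ⊨-exs : ∀ q (φ : Formula (q ℕ.+ m)) ρ → ρ ⊨ exs q φ ⇔ (∃ λ (y : ℝ^ q) → (y Vec.++ ρ) ⊨ φ)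
  ⊨-exs ℕ.zero    φ ρ = mk⇔ (λ p → (λ ()) , p) proj₂
  ⊨-exs (ℕ.suc q) φ ρ = mk⇔
    (λ p → let y , a , r = to (⊨-exs q (ex φ) ρ) p in
      a Vec.∷ y , ⊨-resp φ (λ i → ≡⇒≈ (sym (++-∷ a y i))) r)
    (λ (y , p) → from (⊨-exs q (ex φ) ρ)
      (Vec.tail y , y zero , ⊨-resp φ (λ i → ≡⇒≈ (++-uncons y i)) p))
    where
    ++-uncons : ∀ (y : ℝ^ (ℕ.suc q)) i → (y Vec.++ ρ) i ≡ (y zero Vec.∷ (Vec.tail y Vec.++ ρ)) i
    ++-uncons y zero = refl
    ++-uncons y (suc i) with splitAt q i
    ... | inj₁ _ = refl
    ... | inj₂ _ = refl

    ++-∷ : ∀ a (y : ℝ^ q) i → ((a Vec.∷ y) Vec.++ ρ) i ≡ (a Vec.∷ (y Vec.++ ρ)) i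
    ++-∷ a y = ++-uncons (a Vec.∷ y)

  -- Refining a finite definable cover to a partition

  infixl 7 _∩ᶠ_

  _∩ᶠ_ : Subset n ℓ → Formula n → Subset n ℓ
  D ∩ᶠ χ = record
    { pred = λ x → x ∈ D × x ⊨ χ
    ; resp = λ x≋y (x∈D , p) → resp D x≋y x∈D , ⊨-resp χ x≋y p
    }

  ∩ᶠ-definable : ∀ (D : Subset n ℓ) χ → Definable D → Definable (D ∩ᶠ χ)
  ∩ᶠ-definable D χ (δ , D⇔δ) = δ and χ , λ x → mk⇔
    (λ (x∈D , p) → to (D⇔δ x) x∈D , p)
    (λ (d , p) → from (D⇔δ x) d , p)

  Refinement : Subset n ℓ → List (Formula n) → Set (Level.suc ℓ)
  Refinement D χs = Σ (FinitePartition D) λ Π → let open FinitePartition Π in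
    ∀ i → Definable (block i) × (∃ λ χ → χ ∈ₗ χs × (∀ {x} → x ∈ block i → x ⊨ χ))

  -- Each formula takes what the earlier ones left over: one block is cut out by `χ`, and the
  -- recursion partitions the part where `χ` fails, which is again definable.
  refinement : (χs : List (Formula n)) (D : Subset n ℓ) → Definable D →
    (∀ {x} → x ∈ D → ∃ λ χ → χ ∈ₗ χs × x ⊨ χ) → Refinement D χs
  refinement {n} [] D _ cover = record
    { size      = 0
    ; block     = λ ()
    ; included  = λ ()
    ; covering  = λ x∈D → contradiction (proj₁ (proj₂ (cover x∈D))) λ ()
    ; disjoint  = λ {i} → ⊥-elim (no-block i)
    ; inhabited = λ ()
    } , λ ()
    where
    no-block : ¬ Fin 0
    no-block ()
  refinement {n} (χ ∷ χs) D D-def cover = extend-by emℓ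
    where
    D₁ = D ∩ᶠ χ
    D₂ = D ∩ᶠ (not χ)

    cover₂ : ∀ {x} → x ∈ D₂ → ∃ λ χ → χ ∈ₗ χs × x ⊨ χ
    cover₂ (x∈D , ¬p) with cover x∈D
    ... | _ , here refl , p = contradiction p ¬p
    ... | χ′ , there χ′∈ , p = χ′ , χ′∈ , p

    tail-refinement : Refinement D₂ χs
    tail-refinement = refinement χs D₂ (∩ᶠ-definable D (not χ) D-def) cover₂

    open FinitePartition (proj₁ tail-refinement)

    -- Blocks of a partition are inhabited, so `χ` contributes a block only if some point of `D`
    -- satisfies it.
    extend-by : Dec (∃ λ x → x ∈ D₁) → Refinement D (χ ∷ χs)
    extend-by (yes (x₁ , x₁∈D₁)) = record
      { size      = ℕ.suc size
      ; block     = D₁ Vec.∷ block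
      ; included  = λ { zero (x∈D , _) → x∈D ; (suc i) x∈ → proj₁ (included i x∈) }
      ; covering  = λ x∈D → cover-by x∈D em
      ; disjoint  = λ
          { {zero}  {zero}  i≢j → contradiction refl i≢j
          ; {zero}  {suc j} _ x ((_ , p) , x∈) → proj₂ (included j x∈) p
          ; {suc i} {zero}  _ x (x∈ , (_ , p)) → proj₂ (included i x∈) p
          ; {suc i} {suc j} i≢j → disjoint (i≢j ∘ cong suc)
          }
      ; inhabited = λ { zero → x₁ , x₁∈D₁ ; (suc i) → inhabited i }
      } , λ
      { zero → ∩ᶠ-definable D χ D-def , χ , here refl , proj₂
      ; (suc i) → let def , χ′ , χ′∈ , p = proj₂ tail-refinement i in def , χ′ , there χ′∈ , p
      }
      where
      cover-by : ∀ {x} → x ∈ D → Dec (x ⊨ χ) → ∃ λ i → x ∈ (D₁ Vec.∷ block) i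
      cover-by x∈D (yes p) = zero , x∈D , p
      cover-by x∈D (no ¬p) = let i , x∈ = covering (x∈D , ¬p) in suc i , x∈
    extend-by (no empty) = record
      { size      = size
      ; block     = block
      ; included  = λ i x∈ → proj₁ (included i x∈)
      ; covering  = λ x∈D → covering (x∈D , λ p → empty (_ , x∈D , p))
      ; disjoint  = disjoint
      ; inhabited = inhabited
      } , λ i → let def , χ′ , χ′∈ , p = proj₂ tail-refinement i in def , χ′ , there χ′∈ , p

  affine-row : ∀ (M : Matrix q n) v a i → affine M v a i ≈ ⟦ row (M i) (v i) ⟧ a
  affine-row M v a i = ≗⇒≈ {affine M v a i} {⟦ row (M i) (v i) ⟧ a}
    λ j → seq-row (λ k → M i k · a k) (M i) (v i) a j (λ _ → refl)

  affine-coefficients : ∀ (ls : Vector (Aff n) q) a i →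
    ⟦ ls i ⟧ a ≈ affine (coefficients ∘ ls) (constant ∘ ls) a i
  affine-coefficients ls a i = ≗⇒≈ {⟦ ls i ⟧ a} {affine (coefficients ∘ ls) (constant ∘ ls) a i} λ j →
    sym (trans
      (seq-row (λ k → coefficients (ls i) k · a k) (coefficients (ls i)) (constant (ls i)) a j (λ _ → refl))
      (cong (λ l → seq (⟦ l ⟧ a) j) (row-coefficients (ls i))))

  -- The two directions of the equivalence

  module _ (f : PartialFunction n q ℓ) where

    apply-cong : ∀ {x y} (x∈ : x ∈ dom f) (y∈ : y ∈ dom f) → (∀ i → x i ≡ y i) →
      apply f x x∈ ≋ apply f y y∈
    apply-cong x∈ y∈ eq = cong-apply f x∈ y∈ λ i → ≡⇒≈ (eq i)

    -- The graph is the finite union, over the blocks, of the points whose first `n` coordinates lie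
    -- in the block and whose last `q` satisfy its affine equations.
    piecewise⇒definable : PiecewiseLinear f → DefinableFunction f
    piecewise⇒definable (Π , pieces) = ⋁ pieceFormula , λ z → mk⇔ (graph⇒ z) (graph⇐ z)
      where
      open FinitePartition Π

      δ : Fin size → Formula n
      δ i = proj₁ (proj₁ (pieces i))

      block⇔ : ∀ i x → x ∈ block i ⇔ x ⊨ δ i
      block⇔ i = proj₂ (proj₁ (pieces i))

      form-of : Fin size → Fin q → Aff n
      form-of i k = let M , v , _ = proj₂ (pieces i) in row (M k) (v k)

      apply-form : ∀ i {x} (x∈ : x ∈ block i) (x∈dom : x ∈ dom f) k →
        apply f x x∈dom k ≈ ⟦ form-of i k ⟧ x
      apply-form i {x} x∈ x∈dom k = let M , v , lin = proj₂ (pieces i) in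
        ≈-trans {apply f x x∈dom k} {apply f x (included i x∈) k} {⟦ form-of i k ⟧ x}
          (apply-cong x∈dom (included i x∈) (λ _ → refl) k)
          (≈-trans {apply f x (included i x∈) k} {affine M v x k} {⟦ form-of i k ⟧ x}
            (lin x x∈ k) (affine-row M v x k))

      equations : Fin size → Fin q → Formula (n ℕ.+ q)
      equations i k = equals (n ↑ʳ k) (_↑ˡ q) (form-of i k)

      pieceFormula : Fin size → Formula (n ℕ.+ q)
      pieceFormula i = ren (_↑ˡ q) (δ i) and ⋀ (equations i)

      graph⇒ : ∀ z → z ∈ Graph f → z ⊨ ⋁ pieceFormula
      graph⇒ z (x∈dom , y≋fx) = let i , x∈ = covering x∈dom in
        from (⊨-⋁ pieceFormula) (i ,
          from (⊨-ren (_↑ˡ q) (δ i) λ _ → refl) (to (block⇔ i _) x∈) ,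
          from (⊨-⋀ (equations i) z) λ k → from (⊨-equals (n ↑ʳ k) (_↑ˡ q) (form-of i k) z)
            (≈-trans {z (n ↑ʳ k)} {apply f _ x∈dom k} {⟦ form-of i k ⟧ (Vec.take n z)}
              (y≋fx k) (apply-form i x∈ x∈dom k)))

      graph⇐ : ∀ z → z ⊨ ⋁ pieceFormula → z ∈ Graph f
      graph⇐ z z⊨ =
        let i , z⊨δ , z⊨eqs = to (⊨-⋁ pieceFormula) z⊨
            x∈ = from (block⇔ i (Vec.take n z)) (to (⊨-ren (_↑ˡ q) (δ i) λ _ → refl) z⊨δ)
            x∈dom = included i x∈
        in x∈dom , λ k →
          ≈-trans {z (n ↑ʳ k)} {⟦ form-of i k ⟧ (Vec.take n z)} {apply f _ x∈dom k}
            (to (⊨-equals (n ↑ʳ k) (_↑ˡ q) (form-of i k) z) (to (⊨-⋀ (equations i) z) z⊨eqs k))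
            (≈-sym {apply f _ x∈dom k} {⟦ form-of i k ⟧ (Vec.take n z)} (apply-form i x∈ x∈dom k))

    -- Choosing one candidate form per coordinate gives finitely many definable sets on which `f` is
    -- affine. They cover the domain, and `refinement` makes the cover disjoint.
    definable⇒piecewise : DefinableFunction f → PiecewiseLinear f
    definable⇒piecewise (φ , graph⇔φ) =
      let Π , blocks = refinement pieces (dom f) dom-definable cover
      in Π , λ i → let def , χ , χ∈ , p = blocks i in
         def , linear (FinitePartition.block Π i) (FinitePartition.included Π i) χ∈ p
      where
      graph⇒ : ∀ {x y} → (x Vec.++ y) ⊨ φ → Σ (x ∈ dom f) λ x∈ → y ≋ apply f x x∈
      graph⇒ {x} {y} p =
        let x′∈ , y≋fx′ = from (graph⇔φ (x Vec.++ y)) p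
            x∈ = resp (dom f) (λ i → ≡⇒≈ (lookup-++ˡ x y i)) x′∈
        in x∈ , λ i →
          ≈-trans {y i} {(x Vec.++ y) (n ↑ʳ i)} {apply f x x∈ i} (≡⇒≈ (sym (lookup-++ʳ x y i)))
            (≈-trans {(x Vec.++ y) (n ↑ʳ i)} {apply f _ x′∈ i} {apply f x x∈ i}
              (y≋fx′ i) (apply-cong x′∈ x∈ (lookup-++ˡ x y) i))

      graph⇐ : ∀ {x} (x∈ : x ∈ dom f) → (x Vec.++ apply f x x∈) ⊨ φ
      graph⇐ {x} x∈ =
        let y = apply f x x∈
            x′∈ = resp (dom f) (λ i → ≡⇒≈ (sym (lookup-++ˡ x y i))) x∈
        in to (graph⇔φ _) (x′∈ , λ i →
          ≈-trans {(x Vec.++ y) (n ↑ʳ i)} {y i} {apply f _ x′∈ i} (≡⇒≈ (lookup-++ʳ x y i))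
            (apply-cong x∈ x′∈ (sym ∘ lookup-++ˡ x y) i))

      -- Substitutes the value of `f` for the first `q` variables of `χ`: the graph admits only one
      -- `y` per argument, so the existential speaks of that value and forces the argument into the
      -- domain. The argument is read through `g`, as it may sit behind other variables.
      atValue : (Fin n → Fin k) → Formula (q ℕ.+ k) → Formula k
      atValue g χ = exs q (ren (rotate n g) φ and χ)

      ⊨-atValue : ∀ (g : Fin n → Fin k) χ ρ →
        ρ ⊨ atValue g χ ⇔ (Σ ((ρ ∘ g) ∈ dom f) λ x∈ → (apply f (ρ ∘ g) x∈ Vec.++ ρ) ⊨ χ)
      ⊨-atValue g χ ρ = mk⇔
        (λ p → let y , yρ⊨φ , yρ⊨χ = to (⊨-exs q (ren (rotate n g) φ and χ) ρ) p
                   x∈ , y≋fx = graph⇒ (to (⊨-ren (rotate n g) φ (lookup-rotate n g y ρ)) yρ⊨φ)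
               in x∈ , ⊨-resp χ (++-≋ y≋fx) yρ⊨χ)
        (λ (x∈ , p) → from (⊨-exs q (ren (rotate n g) φ and χ) ρ)
          (apply f _ x∈ , from (⊨-ren (rotate n g) φ (lookup-rotate n g (apply f _ x∈) ρ)) (graph⇐ x∈) , p))
        where
        ++-≋ : ∀ {y y′ : ℝ^ q} → y ≋ y′ → (y Vec.++ ρ) ≋ (y′ Vec.++ ρ)
        ++-≋ y≋y′ i with splitAt q i
        ... | inj₁ j = y≋y′ j
        ... | inj₂ j = ≈-refl {ρ j}

      -- With a trivially true `χ`, `atValue` says only that a value exists.
      dom-definable : Definable (dom f)
      dom-definable = atValue id (const 0ℚ ≐ const 0ℚ) , λ x → mk⇔
        (λ x∈ → from (⊨-atValue id (const 0ℚ ≐ const 0ℚ) x) (x∈ , ≈-refl {0ᴿ}))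
        (λ p → proj₁ (to (⊨-atValue id (const 0ℚ ≐ const 0ℚ) x) p))

      -- Variable 0 is the value, the others are the argument.
      coordinateGraph : Fin q → Formula (ℕ.suc n)
      coordinateGraph i = atValue suc (var (i ↑ˡ ℕ.suc n) ≐ var (q ↑ʳ zero))

      candidates : Fin q → List (Aff n)
      candidates i = thresholds (signs (coordinateGraph i))

      -- Over `x`, the formula `coordinateGraph i` has the `i`-th coordinate of the value as its
      -- only solution, so that coordinate is a threshold.
      candidate : ∀ {x} (x∈ : x ∈ dom f) i → ∃ λ l → l ∈ₗ candidates i × apply f x x∈ i ≈ ⟦ l ⟧ x
      candidate {x} x∈ i =
        let l , l∈ , l≈ = unique⇒threshold (coordinateGraph i) value unique
        in l , l∈ , ≈-sym {⟦ l ⟧ x} {apply f x x∈ i} l≈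
        where
        y = apply f x x∈
        χ = var (i ↑ˡ ℕ.suc n) ≐ var (q ↑ʳ zero)

        value : (y i Vec.∷ x) ⊨ coordinateGraph i
        value = from (⊨-atValue suc χ (y i Vec.∷ x)) (x∈ ,
          ≡⇒≈ (trans (lookup-++ˡ y (y i Vec.∷ x) i) (sym (lookup-++ʳ y (y i Vec.∷ x) zero))))

        unique : ∀ z → (z Vec.∷ x) ⊨ coordinateGraph i → z ≈ y i
        unique z p =
          let x∈′ , y′≈z = to (⊨-atValue suc χ (z Vec.∷ x)) p
              y′ = apply f x x∈′
          in ≈-trans {z} {y′ i} {y i}
            (≈-sym {y′ i} {z} (subst₂ _≈_ (lookup-++ˡ y′ (z Vec.∷ x) i) (lookup-++ʳ y′ (z Vec.∷ x) zero) y′≈z))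
            (apply-cong x∈′ x∈ (λ _ → refl) i)

      equations : Vector (Aff n) q → Fin q → Formula (q ℕ.+ n)
      equations ls i = equals (i ↑ˡ n) (q ↑ʳ_) (ls i)

      agrees : Vector (Aff n) q → Formula n
      agrees ls = atValue id (⋀ (equations ls))

      ⊨-equation : ∀ ls (y : ℝ^ q) (x : ℝ^ n) i → (y Vec.++ x) ⊨ equations ls i ⇔ y i ≈ ⟦ ls i ⟧ x
      ⊨-equation ls y x i = ⇔.trans (⊨-equals (i ↑ˡ n) (q ↑ʳ_) (ls i) (y Vec.++ x))
        (mk⇔ (same-≈ same) (same-≈ (same-sym same)))
        where
        same : SameOrder ((y Vec.++ x) (i ↑ˡ n)) (⟦ ls i ⟧ ((y Vec.++ x) ∘ (q ↑ʳ_))) (y i) (⟦ ls i ⟧ x)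
        same = same-cong (≡⇒≈ (lookup-++ˡ y x i)) (⟦⟧-cong (ls i) λ j → ≡⇒≈ (lookup-++ʳ y x j))

      ⊨-agrees : ∀ ls x → x ⊨ agrees ls ⇔ (Σ (x ∈ dom f) λ x∈ → ∀ i → apply f x x∈ i ≈ ⟦ ls i ⟧ x)
      ⊨-agrees ls x = mk⇔
        (λ p → let x∈ , eqs = to (⊨-atValue id (⋀ (equations ls)) x) p in x∈ , λ i →
          to (⊨-equation ls (apply f x x∈) x i) (to (⊨-⋀ (equations ls) (apply f x x∈ Vec.++ x)) eqs i))
        (λ (x∈ , eqs) → from (⊨-atValue id (⋀ (equations ls)) x)
          (x∈ , from (⊨-⋀ (equations ls) (apply f x x∈ Vec.++ x)) λ i →
            from (⊨-equation ls (apply f x x∈) x i) (eqs i)))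

      pieces : List (Formula n)
      pieces = map agrees (choices candidates)

      cover : ∀ {x} → x ∈ dom f → ∃ λ χ → χ ∈ₗ pieces × x ⊨ χ
      cover {x} x∈ =
        let ls , ls∈ , eqs = choose candidates (λ i l → apply f x x∈ i ≈ ⟦ l ⟧ x) (candidate x∈)
        in agrees ls , ∈-map⁺ agrees ls∈ , from (⊨-agrees ls x) (x∈ , eqs)

      linear-on : ∀ ls (B : Subset n ℓ) (B⊆dom : ∀ {x} → x ∈ B → x ∈ dom f) →
        (∀ {x} → x ∈ B → x ⊨ agrees ls) → Linear (restrict f B B⊆dom)
      linear-on ls B B⊆dom B⊆agrees = coefficients ∘ ls , constant ∘ ls , λ x x∈B i →
        let x∈ , eqs = to (⊨-agrees ls x) (B⊆agrees x∈B)
        in ≈-trans {apply f x (B⊆dom x∈B) i} {apply f x x∈ i} {affine (coefficients ∘ ls) (constant ∘ ls) x i}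
             (apply-cong (B⊆dom x∈B) x∈ (λ _ → refl) i)
             (≈-trans {apply f x x∈ i} {⟦ ls i ⟧ x} {affine (coefficients ∘ ls) (constant ∘ ls) x i}
               (eqs i) (affine-coefficients ls x i))

      linear : ∀ {χ} (B : Subset n ℓ) (B⊆dom : ∀ {x} → x ∈ B → x ∈ dom f) → χ ∈ₗ pieces →
        (∀ {x} → x ∈ B → x ⊨ χ) → Linear (restrict f B B⊆dom)
      linear B B⊆dom χ∈ B⊆χ =
        let ls , _ , χ≡agrees = ∈-map⁻ agrees χ∈
        in linear-on ls B B⊆dom λ {x} x∈B → subst (x ⊨_) χ≡agrees (B⊆χ x∈B)

theorem3p4 : ∀ {ℓ} → ExcludedMiddle ℓ →
    ∀ (n q : ℕ) → 1 ≤ n → 1 ≤ q →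
    (f : PartialFunction n q ℓ) →
    DefinableFunction f ⇔ PiecewiseLinear f
theorem3p4 em n q _ _ f = mk⇔ (definable⇒piecewise f) (piecewise⇒definable f)
  where open Piecewise em
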